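{- For non-zero integers $a,b$ let $f_{a,b}:(0,\infty)\to(0,\infty)$, $f_{a,b}(z)=z^{a/b}$ (real positive branch). Let $I\subseteq(0,\infty)$ have non-empty interior. Then there exist uncountably many $\zeta\in\mathscr{L}\cap(0,\infty)$ such that $f_{a,b}(\zeta)\in\mathscr{L}$ simultaneously for all non-zero integers $a,b$. Moreover, for any fixed non-zero integers $a,b$, there are uncountably many $\zeta\in\mathscr{L}\cap I$ with $f_{a,b}(\zeta)\in\mathscr{L}$.
   Context: $\mathscr{L}$ is the set of Liouville numbers (real irrational $\zeta$ such that for every $\eta>0$ there are infinitely many rationals $y/x$, $x\geq1$, with $|\zeta-y/x|\leq x^{ -\eta}$). -}

module Defs where

open import Level using (0ℓ) renaming (_⊔_ to _⊔ˡ_; suc to lsuc)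
open import Algebra.Bundles using (CommutativeRing)
open import Data.Nat.Base as ℕ using (ℕ; zero; suc)
import Data.Nat.Properties as ℕₚ
open import Data.Integer.Base as ℤ using (ℤ; +_; -[1+_])
import Data.Integer.Properties as ℤₚ
open import Data.Rational.Base
open import Data.Rational.Properties
import Data.Rational.Unnormalised.Base as ℚᵘ
import Data.Rational.Unnormalised.Properties as ℚᵘₚ
open import Data.Rational.Solver using (module +-*-Solver)
open import Data.Integer.Solver using () renaming (module +-*-Solver to ℤ-Solver)
open import Data.List.Base using (List)
open import Data.List.Membership.Propositional using (_∉_)
open import Data.Product.Base using (Σ; ∃; ∃₂; ∃-syntax; Σ-syntax; _×_; _,_; proj₁; proj₂)
open import Data.Sum.Base using (_⊎_; inj₁; inj₂; swap) renaming (map to map⊎)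
open import Data.Empty using (⊥; ⊥-elim)
open import Relation.Nullary using (¬_; yes; no)
open import Relation.Unary using (Pred)
open import Relation.Binary.Definitions using (tri<; tri≈; tri>)
open import Relation.Binary.PropositionalEquality
  using (_≡_; refl; sym; trans; cong; cong₂; subst; subst₂)
open import Algebra.Properties.CommutativeSemiring.Exp
  (CommutativeRing.commutativeSemiring +-*-commutativeRing) public
  using (_^_; ^-homo-*; ^-assocʳ; ^-distrib-*)

open +-*-Solver using (solve; _:=_; _:+_; _:*_; :-_; con)
open ℤ-Solver using ()
  renaming (solve to ℤsolve; _:=_ to _⊜_; _:+_ to _⊕_; _:*_ to _⊗_; con to ℤcon)

0<1 : 0ℚ < 1ℚ
0<1 = positive⁻¹ 1ℚ

≤or> : ∀ p q → p ≤ q ⊎ q < p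
≤or> p q with p ≤? q
... | yes p≤q = inj₁ p≤q
... | no  p≰q = inj₂ (≰⇒> p≰q)

*-pos : ∀ {p q} → 0ℚ < p → 0ℚ < q → 0ℚ < p * q
*-pos {p} {q} 0<p 0<q =
  positive⁻¹ (p * q) {{pos*pos⇒pos p {{positive 0<p}} q {{positive 0<q}}}}

*-mono-≤ˡ : ∀ {r p q} → 0ℚ ≤ r → p ≤ q → r * p ≤ r * q
*-mono-≤ˡ {r} 0≤r = *-monoˡ-≤-nonNeg r {{nonNegative 0≤r}}

*-mono-≤ʳ : ∀ {r p q} → 0ℚ ≤ r → p ≤ q → p * r ≤ q * r
*-mono-≤ʳ {r} 0≤r = *-monoʳ-≤-nonNeg r {{nonNegative 0≤r}}

*-mono-<ˡ : ∀ {r p q} → 0ℚ < r → p < q → r * p < r * q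
*-mono-<ˡ {r} 0<r = *-monoʳ-<-pos r {{positive 0<r}}

*-mono-<ʳ : ∀ {r p q} → 0ℚ < r → p < q → p * r < q * r
*-mono-<ʳ {r} 0<r = *-monoˡ-<-pos r {{positive 0<r}}

*-cancel-<ʳ : ∀ {r p q} → 0ℚ < r → p * r < q * r → p < q
*-cancel-<ʳ {r} 0<r = *-cancelʳ-<-nonNeg r {{nonNegative (<⇒≤ 0<r)}}

*-cancel-≤ʳ : ∀ {r p q} → 0ℚ < r → p * r ≤ q * r → p ≤ q
*-cancel-≤ʳ {r} 0<r = *-cancelʳ-≤-pos r {{positive 0<r}}

quotient : ∀ {A B} → 0ℚ < A → 0ℚ < B → ∃[ h ] 0ℚ < h × h * A ≡ B
quotient {A} {B} 0<A 0<B =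
  B * r , *-pos 0<B (positive⁻¹ r {{1/pos⇒pos A {{positive 0<A}}}}) ,
  trans (*-assoc B r A)
    (trans (cong (B *_) (*-inverseˡ A {{>-nonZero 0<A}})) (*-identityʳ B))
  where
  r : ℚ
  r = (1/ A) {{>-nonZero 0<A}}

*-swap : ∀ a b c → a * b * c ≡ a * c * b
*-swap = solve 3 (λ a b c → a :* b :* c := a :* c :* b) refl

^-pos : ∀ {p} n → 0ℚ < p → 0ℚ < p ^ n
^-pos zero    _   = 0<1
^-pos (suc n) 0<p = *-pos 0<p (^-pos n 0<p)

^-mono-≤ : ∀ {p q} n → 0ℚ < p → p ≤ q → p ^ n ≤ q ^ n
^-mono-≤ zero    _   _   = ≤-refl
^-mono-≤ (suc n) 0<p p≤q =
  ≤-trans (*-mono-≤ʳ (<⇒≤ (^-pos n 0<p)) p≤q)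
          (*-mono-≤ˡ (<⇒≤ (<-≤-trans 0<p p≤q)) (^-mono-≤ n 0<p p≤q))

^-mono-< : ∀ {p q} n → 0ℚ < p → p < q → p ^ suc n < q ^ suc n
^-mono-< n 0<p p<q =
  <-≤-trans (*-mono-<ʳ (^-pos n 0<p) p<q)
            (*-mono-≤ˡ (<⇒≤ (<-trans 0<p p<q)) (^-mono-≤ n 0<p (<⇒≤ p<q)))

1≤^ : ∀ {p} n → 1ℚ ≤ p → 1ℚ ≤ p ^ n
1≤^ zero    _   = ≤-refl
1≤^ {p} (suc n) 1≤p =
  ≤-trans 1≤p (≤-trans (≤-reflexive (sym (*-identityʳ p)))
    (*-mono-≤ˡ (≤-trans (<⇒≤ 0<1) 1≤p) (1≤^ n 1≤p)))

^-monoʳ-≤ : ∀ {p m n} → 1ℚ ≤ p → m ℕ.≤ n → p ^ m ≤ p ^ n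
^-monoʳ-≤ {n = n} 1≤p ℕ.z≤n       = 1≤^ n 1≤p
^-monoʳ-≤         1≤p (ℕ.s≤s m≤n) =
  *-mono-≤ˡ (≤-trans (<⇒≤ 0<1) 1≤p) (^-monoʳ-≤ 1≤p m≤n)

^-cancel-< : ∀ {p q} n → 0ℚ < q → p ^ n < q ^ n → p < q
^-cancel-< {p} {q} n 0<q p^n<q^n with ≤or> q p
... | inj₁ q≤p = ⊥-elim (<-irrefl refl (<-≤-trans p^n<q^n (^-mono-≤ n 0<q q≤p)))
... | inj₂ p<q = p<q

i≤∣i∣ : ∀ i → i ℤ.≤ + ℤ.∣ i ∣
i≤∣i∣ (+ n)    = ℤₚ.≤-refl
i≤∣i∣ -[1+ n ] = ℤ.-≤+

ι : ℕ → ℚ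
ι n = + n / 1

ι-suc : ∀ n → ι (suc n) ≡ 1ℚ + ι n
ι-suc n = toℚᵘ-injective
  (ℚᵘₚ.≃-trans (toℚᵘ-fromℚᵘ (ℚᵘ.mkℚᵘ (+ suc n) 0))
    (ℚᵘₚ.≃-trans (ℚᵘ.*≡* (cong (ℤ._* + 1) (sym (cong (ℤ._+_ (+ 1)) (ℤₚ.*-identityʳ (+ n))))))
      (ℚᵘₚ.≃-sym (ℚᵘₚ.≃-trans (toℚᵘ-homo-+ 1ℚ (ι n))
        (ℚᵘₚ.+-congʳ (toℚᵘ 1ℚ) (toℚᵘ-fromℚᵘ (ℚᵘ.mkℚᵘ (+ n) 0)))))))

archimedean : ∀ {ε} B → 0ℚ < ε → ∃[ n ] B < ι n * ε
archimedean {ε} B 0<ε with ≤or> B 0ℚ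
... | inj₁ B≤0 = 1 , <-respʳ-≡ (sym (*-identityˡ ε)) (≤-<-trans B≤0 0<ε)
... | inj₂ 0<B with quotient 0<ε 0<B
...   | h@(mkℚ n d _) , _ , refl = k , *-mono-<ʳ 0<ε h<k
  where
  k : ℕ
  k = suc ℤ.∣ n ∣
  n<k : n ℤ.* + 1 ℤ.< + k ℤ.* + suc d
  n<k = ℤₚ.≤-<-trans (ℤₚ.≤-reflexive (ℤₚ.*-identityʳ n))
    (ℤₚ.≤-<-trans (i≤∣i∣ n)
      (ℤₚ.<-≤-trans (ℤ.+<+ (ℕₚ.n<1+n ℤ.∣ n ∣))
        (subst (+ k ℤ.≤_) (ℤₚ.pos-* k (suc d)) (ℤ.+≤+ (ℕₚ.m≤m*n k (suc d))))))
  h<k : h < ι k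
  h<k = toℚᵘ-cancel-< (ℚᵘₚ.<-respʳ-≃
    (ℚᵘₚ.≃-sym (toℚᵘ-fromℚᵘ (ℚᵘ.mkℚᵘ (+ k) 0))) (ℚᵘ.*<* n<k))

exceeds : ∀ {h} B → 1ℚ < h → ∃[ n ] B < h ^ n
exceeds {h} B 1<h = let n , B<n = archimedean B 0<e in n , <-≤-trans B<n (bernoulli n)
  where
  e : ℚ
  e = h - 1ℚ
  h≡ : h ≡ 1ℚ + e
  h≡ = solve 1 (λ h → h := con 1ℚ :+ (h :+ :- con 1ℚ)) refl h
  0<e : 0ℚ < e
  0<e = +-monoˡ-< (- 1ℚ) 1<h
  bernoulli : ∀ n → ι n * e ≤ h ^ n
  bernoulli zero    = ≤-trans (≤-reflexive (*-zeroˡ e)) (<⇒≤ 0<1)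
  bernoulli (suc n) = begin
    ι (suc n) * e     ≡⟨ cong (_* e) (ι-suc n) ⟩
    (1ℚ + ι n) * e    ≡⟨ solve 2 (λ k e → (con 1ℚ :+ k) :* e := e :+ k :* e) refl (ι n) e ⟩
    e + ι n * e       ≤⟨ +-mono-≤ e≤e*h^n (bernoulli n) ⟩
    e * h ^ n + h ^ n ≡⟨ solve 2 (λ e p → e :* p :+ p := (con 1ℚ :+ e) :* p) refl e (h ^ n) ⟩
    (1ℚ + e) * h ^ n  ≡⟨ cong (_* h ^ n) (sym h≡) ⟩
    h * h ^ n         ∎
    where
    open ≤-Reasoning
    e≤e*h^n : e ≤ e * h ^ n
    e≤e*h^n = ≤-trans (≤-reflexive (sym (*-identityʳ e)))
                      (*-mono-≤ˡ (<⇒≤ 0<e) (1≤^ n (<⇒≤ 1<h)))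

smallRoot : ∀ {h} m → 1ℚ < h → ∃[ g ] 1ℚ < g × g ^ m < h
smallRoot {h} zero 1<h = h , 1<h , 1<h
smallRoot {h} (suc m) 1<h with <-dense 1<h
... | k , 1<k , k<h with quotient (<-trans 0<1 1<k) (<-trans 0<1 1<h)
...   | l , 0<l , l*k≡h
  with smallRoot m (*-cancel-<ʳ (<-trans 0<1 1<k)
         (subst₂ _<_ (sym (*-identityˡ k)) (sym l*k≡h) k<h))
...     | g , 1<g , g^m<l with ≤-total g k
...       | inj₁ g≤k = g , 1<g , subst (g * g ^ m <_) (trans (*-comm k l) l*k≡h)
              (≤-<-trans (*-mono-≤ʳ (<⇒≤ (^-pos m (<-trans 0<1 1<g))) g≤k)
                         (*-mono-<ˡ (<-trans 0<1 1<k) g^m<l))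
...       | inj₂ k≤g = k , 1<k , subst (k * k ^ m <_) (trans (*-comm k l) l*k≡h)
              (*-mono-<ˡ (<-trans 0<1 1<k)
                (≤-<-trans (^-mono-≤ m (<-trans 0<1 1<k) k≤g) g^m<l))

slack : ∀ {A B} m → 0ℚ < A → A < B → ∃[ g ] 1ℚ < g × A * g ^ m < B
slack {A} {B} m 0<A A<B with quotient 0<A (<-trans 0<A A<B)
... | h , 0<h , h*A≡B
  with smallRoot m (*-cancel-<ʳ 0<A (subst₂ _<_ (sym (*-identityˡ A)) (sym h*A≡B) A<B))
...   | g , 1<g , g^m<h =
  g , 1<g , subst (A * g ^ m <_) (trans (*-comm A h) h*A≡B) (*-mono-<ˡ 0<A g^m<h)

^≤1 : ∀ {p} n → 0ℚ < p → p ≤ 1ℚ → p ^ n ≤ 1ℚ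
^≤1 zero    _   _   = ≤-refl
^≤1 {p} (suc n) 0<p p≤1 =
  ≤-trans (*-mono-≤ˡ (<⇒≤ 0<p) (^≤1 n 0<p p≤1)) (≤-trans (≤-reflexive (*-identityʳ p)) p≤1)

tiny : ∀ {W} → 0ℚ < W → ∃[ e ] 0ℚ < e × e ≤ 1ℚ × e < W
tiny {W} 0<W with <-dense 0<W
... | e , 0<e , e<W with ≤-total e 1ℚ
...   | inj₁ e≤1 = e , 0<e , e≤1 , e<W
...   | inj₂ 1≤e = 1ℚ , 0<1 , ≤-refl , ≤-<-trans 1≤e e<W

widenPos : ∀ {q U V} m → 0ℚ < q → 0ℚ < V → q ^ m * V < U →
           ∃[ r ] q < r × 0ℚ < r × r ^ m * V < U
widenPos {q} {U} {V} m 0<q 0<V lt = let g , 1<g , lt′ = slack m (*-pos (^-pos m 0<q) 0<V) lt in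
  q * g , q<q*g g 1<g , <-trans 0<q (q<q*g g 1<g) , subst (_< U) (eq g) lt′
  where
  q<q*g : ∀ g → 1ℚ < g → q < q * g
  q<q*g g 1<g = subst (_< q * g) (*-identityʳ q) (*-mono-<ˡ 0<q 1<g)
  eq : ∀ g → q ^ m * V * g ^ m ≡ (q * g) ^ m * V
  eq g = trans (*-swap (q ^ m) V (g ^ m)) (cong (_* V) (sym (^-distrib-* q g m)))

widenNeg : ∀ {q U V} m → 0ℚ < U → 0ℚ < V → q ≤ 0ℚ →
           ∃[ r ] q < r × 0ℚ < r × r ^ suc m * V < U
widenNeg {q} {U} {V} m 0<U 0<V q≤0 =
  let W , 0<W , W*V≡U = quotient 0<V 0<U
      e , 0<e , e≤1 , e<W = tiny 0<W
  in e , ≤-<-trans q≤0 0<e , 0<e ,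
  ≤-<-trans (*-mono-≤ʳ (<⇒≤ 0<V) (subst (e * e ^ m ≤_) (*-identityʳ e)
              (*-mono-≤ˡ (<⇒≤ 0<e) (^≤1 m 0<e e≤1))))
            (subst (e * V <_) W*V≡U (*-mono-<ʳ 0<V e<W))

shrink : ∀ {q U V} m → 0ℚ < q → 0ℚ < U → U < q ^ m * V →
         ∃[ r ] r < q × 0ℚ < r × U < r ^ m * V
shrink {q} {U} {V} m 0<q 0<U lt with slack m 0<U lt
... | g , 1<g , lt′ with quotient (<-trans 0<1 1<g) 0<q
...   | r , 0<r , refl = r , r<q , 0<r , *-cancel-<ʳ (^-pos m (<-trans 0<1 1<g)) (subst (U * g ^ m <_) eq lt′)
  where
  r<q : r < r * g
  r<q = subst (_< r * g) (*-identityʳ r) (*-mono-<ˡ 0<r 1<g)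
  eq : (r * g) ^ m * V ≡ r ^ m * V * g ^ m
  eq = trans (cong (_* V) (^-distrib-* r g m))
    (*-swap (r ^ m) (g ^ m) V)

widen : ∀ {q U V} m → 0ℚ < U → 0ℚ < V → q ≤ 0ℚ ⊎ q ^ suc m * V < U →
        ∃[ r ] q < r × 0ℚ < r × r ^ suc m * V < U
widen {q} m 0<U 0<V (inj₁ q≤0) = widenNeg m 0<U 0<V q≤0
widen {q} m 0<U 0<V (inj₂ lt) = go (≤or> q 0ℚ)
  where
  go : q ≤ 0ℚ ⊎ 0ℚ < q → _
  go (inj₁ q≤0) = widenNeg m 0<U 0<V q≤0
  go (inj₂ 0<q) = widenPos (suc m) 0<q 0<V lt

large : ∀ {U V} m → 0ℚ < U → 0ℚ < V → ∃[ q ] 0ℚ < q × U < q ^ suc m * V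
large {U} {V} m 0<U 0<V = q , 0<q , subst (_< q ^ suc m * V) (proj₂ (proj₂ quot))
    (*-mono-<ʳ 0<V (<-≤-trans W<q
      (subst (_≤ q * q ^ m) (*-identityʳ q) (*-mono-≤ˡ (<⇒≤ 0<q) (1≤^ m 1≤q)))))
  where
  quot = quotient 0<V 0<U
  W q : ℚ
  W = proj₁ quot
  q = W + 1ℚ
  W<q : W < q
  W<q = subst (_< q) (+-identityʳ W) (+-monoʳ-< W 0<1)
  0<q : 0ℚ < q
  0<q = <-trans (proj₁ (proj₂ quot)) W<q
  1≤q : 1ℚ ≤ q
  1≤q = subst (_≤ q) (+-identityˡ 1ℚ) (+-monoˡ-≤ 1ℚ (<⇒≤ (proj₁ (proj₂ quot))))

-- L q means q < x and U q means x < q.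
record ℝ : Set₁ where
  field
    L U      : ℚ → Set
    L-inhab  : ∃ L
    U-inhab  : ∃ U
    L-down   : ∀ {p q} → p < q → L q → L p
    U-up     : ∀ {p q} → p < q → U p → U q
    L-open   : ∀ {q} → L q → ∃[ r ] q < r × L r
    U-open   : ∀ {q} → U q → ∃[ r ] r < q × U r
    disjoint : ∀ {q} → L q → U q → ⊥
    located  : ∀ {p q} → p < q → L p ⊎ U q

open ℝ public

infix 4 _<ᴿ_ _≤ᴿ_ _≃ᴿ_ _#ᴿ_

_<ᴿ_ : ℝ → ℝ → Set
x <ᴿ y = ∃[ q ] U x q × L y q

_≤ᴿ_ : ℝ → ℝ → Set
x ≤ᴿ y = ∀ q → L x q → L y q

_≃ᴿ_ : ℝ → ℝ → Set
x ≃ᴿ y = x ≤ᴿ y × y ≤ᴿ x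

_#ᴿ_ : ℝ → ℝ → Set
x #ᴿ y = x <ᴿ y ⊎ y <ᴿ x

fromℚ : ℚ → ℝ
fromℚ q = record
  { L = _< q ; U = q <_
  ; L-inhab = q - 1ℚ , subst (q - 1ℚ <_) (+-identityʳ q) (+-monoʳ-< q (negative⁻¹ (- 1ℚ)))
  ; U-inhab = q + 1ℚ , subst (_< q + 1ℚ) (+-identityʳ q) (+-monoʳ-< q 0<1)
  ; L-down = <-trans
  ; U-up = λ p<r q<p → <-trans q<p p<r
  ; L-open = λ p<q → <-dense p<q
  ; U-open = λ q<p → let r , q<r , r<p = <-dense q<p in r , r<p , q<r
  ; disjoint = λ p<q q<p → <-irrefl refl (<-trans p<q q<p)
  ; located = λ {p} p<r → loc p<r (≤or> q p)
  }
  where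
  loc : ∀ {p r} → p < r → q ≤ p ⊎ p < q → p < q ⊎ q < r
  loc p<r (inj₁ q≤p) = inj₂ (≤-<-trans q≤p p<r)
  loc p<r (inj₂ p<q) = inj₁ p<q

0ᴿ : ℝ
0ᴿ = fromℚ 0ℚ

L<U : ∀ x {p q} → L x p → U x q → p < q
L<U x {p} {q} Lp Uq = go (<-cmp p q)
  where
  go : _ → p < q
  go (tri< p<q _ _)  = p<q
  go (tri≈ _ refl _) = ⊥-elim (disjoint x Lp Uq)
  go (tri> _ _ q<p)  = ⊥-elim (disjoint x (L-down x q<p Lp) Uq)

approximate : ∀ x {ε} → 0ℚ < ε → ∃₂ λ p q → L x p × U x q × q < p + ε
approximate x {ε} 0<ε =
  let δ , 0<δ , δ+δ<ε = half
      l , Ll = L-inhab x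
      u , Uu = U-inhab x
      k , u-l<kδ = archimedean (u - l) 0<δ
      p , Lp , Up = walk δ 0<δ k l Ll
        (U-up x (subst (_< l + ι k * δ) (cancel l u) (+-monoʳ-< l u-l<kδ)) Uu)
  in p , p + (δ + δ) , Lp , Up , +-monoʳ-< p δ+δ<ε
  where
  cancel : ∀ l u → l + (u - l) ≡ u
  cancel = solve 2 (λ l u → l :+ (u :+ :- l) := u) refl
  step : ∀ p k δ → p + (1ℚ + k) * δ ≡ (p + δ) + k * δ
  step = solve 3 (λ p k δ → p :+ (con 1ℚ :+ k) :* δ := (p :+ δ) :+ k :* δ) refl
  half : ∃[ δ ] 0ℚ < δ × δ + δ < ε
  half = let d , 0<d , d<ε = <-dense 0<ε in
    d * ½ , *-pos 0<d (positive⁻¹ ½) , subst (_< ε) (halves d) d<ε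
    where
    halves : ∀ d → d ≡ d * ½ + d * ½
    halves = solve 1 (λ d → d := d :* con ½ :+ d :* con ½) refl
  walk : ∀ δ → 0ℚ < δ → ∀ k p → L x p → U x (p + ι k * δ) →
         ∃[ p′ ] L x p′ × U x (p′ + (δ + δ))
  walk δ 0<δ zero p Lp Up = ⊥-elim (disjoint x Lp
    (subst (U x) (trans (cong (_+_ p) (*-zeroˡ δ)) (+-identityʳ p)) Up))
  walk δ 0<δ (suc k) p Lp Up = go (located x (+-monoʳ-< p δ<δ+δ))
    where
    δ<δ+δ : δ < δ + δ
    δ<δ+δ = subst (_< δ + δ) (+-identityʳ δ) (+-monoʳ-< δ 0<δ)
    go : L x (p + δ) ⊎ U x (p + (δ + δ)) → _
    go (inj₁ L′) = walk δ 0<δ k (p + δ) L′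
      (subst (U x) (trans (cong (λ n → p + n * δ) (ι-suc k)) (step p (ι k) δ)) Up)
    go (inj₂ U′) = p , Lp , U′

-ᴿ_ : ℝ → ℝ
-ᴿ x = record
  { L = λ q → U x (- q) ; U = λ q → L x (- q)
  ; L-inhab = let u , Uu = U-inhab x in - u , subst (U x) (sym (neg-inv u)) Uu
  ; U-inhab = let l , Ll = L-inhab x in - l , subst (L x) (sym (neg-inv l)) Ll
  ; L-down = λ p<q → U-up x (neg-antimono-< p<q)
  ; U-up = λ p<q → L-down x (neg-antimono-< p<q)
  ; L-open = λ {q} Uq → let r , r<q , Ur = U-open x Uq in
      - r , subst (_< - r) (neg-inv q) (neg-antimono-< r<q) , subst (U x) (sym (neg-inv r)) Ur
  ; U-open = λ {q} Lq → let r , q<r , Lr = L-open x Lq in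
      - r , subst (- r <_) (neg-inv q) (neg-antimono-< q<r) , subst (L x) (sym (neg-inv r)) Lr
  ; disjoint = λ Uq Lq → disjoint x Lq Uq
  ; located = λ p<q → swap (located x (neg-antimono-< p<q))
  }
  where
  neg-inv : ∀ q → - - q ≡ q
  neg-inv = solve 1 (λ q → :- (:- q) := q) refl

infixl 6 _+ᴿ_ _-ᴿ_

_+ᴿ_ : ℝ → ℝ → ℝ
x +ᴿ y = record
  { L = λ t → ∃₂ λ p q → L x p × L y q × t < p + q
  ; U = λ t → ∃₂ λ p q → U x p × U y q × p + q < t
  ; L-inhab = let p , Lp = L-inhab x ; q , Lq = L-inhab y ; t , t< = L-inhab (fromℚ (p + q)) in
      t , p , q , Lp , Lq , t<
  ; U-inhab = let p , Up = U-inhab x ; q , Uq = U-inhab y ; t , <t = U-inhab (fromℚ (p + q)) in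
      t , p , q , Up , Uq , <t
  ; L-down = λ s<t (p , q , Lp , Lq , t<) → p , q , Lp , Lq , <-trans s<t t<
  ; U-up = λ s<t (p , q , Up , Uq , <s) → p , q , Up , Uq , <-trans <s s<t
  ; L-open = λ (p , q , Lp , Lq , t<) → let r , t<r , r< = <-dense t< in r , t<r , p , q , Lp , Lq , r<
  ; U-open = λ (p , q , Up , Uq , <t) → let r , <r , r<t = <-dense <t in r , r<t , p , q , Up , Uq , <r
  ; disjoint = λ (p , q , Lp , Lq , t<) (p′ , q′ , Up , Uq , <t) →
      <-irrefl refl (<-trans (<-trans t< (+-mono-< (L<U x Lp Up) (L<U y Lq Uq))) <t)
  ; located = loc
  }
  where
  quarter : ∀ s t → s + ((t - s) * ½ + (t - s) * ½) ≡ t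
  quarter = solve 2 (λ s t → s :+ ((t :+ :- s) :* con ½ :+ (t :+ :- s) :* con ½) := t) refl
  regroup : ∀ p q ε → (p + ε) + (q + ε) ≡ (p + q) + (ε + ε)
  regroup = solve 3 (λ p q ε → (p :+ ε) :+ (q :+ ε) := (p :+ q) :+ (ε :+ ε)) refl
  LowerSum UpperSum : ℚ → Set
  LowerSum t = ∃₂ λ p q → L x p × L y q × t < p + q
  UpperSum t = ∃₂ λ p q → U x p × U y q × p + q < t
  decide : ∀ {s t} ε → s + (ε + ε) ≡ t →
    (∃₂ λ p p′ → L x p × U x p′ × p′ < p + ε) → (∃₂ λ q q′ → L y q × U y q′ × q′ < q + ε) →
    LowerSum s ⊎ UpperSum t
  decide {s} {t} ε eq (p , p′ , Lp , Up , p′<) (q , q′ , Lq , Uq , q′<) = go (≤or> (p + q) s)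
    where
    go : p + q ≤ s ⊎ s < p + q → LowerSum s ⊎ UpperSum t
    go (inj₂ s<) = inj₁ (p , q , Lp , Lq , s<)
    go (inj₁ ≤s) = inj₂ (p′ , q′ , Up , Uq ,
      <-≤-trans (+-mono-< p′< q′<)
        (subst₂ _≤_ (sym (regroup p q ε)) eq (+-monoˡ-≤ (ε + ε) ≤s)))
  loc : ∀ {s t} → s < t → LowerSum s ⊎ UpperSum t
  loc {s} {t} s<t = decide ((t - s) * ½) (quarter s t) (approximate x 0<ε) (approximate y 0<ε)
    where
    0<ε : 0ℚ < (t - s) * ½
    0<ε = *-pos (subst (_< t - s) (+-inverseʳ s) (+-monoˡ-< (- s) s<t)) (positive⁻¹ ½)

_-ᴿ_ : ℝ → ℝ → ℝ
x -ᴿ y = x +ᴿ (-ᴿ y)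

∣_∣ᴿ : ℝ → ℝ
∣ x ∣ᴿ = record
  { L = λ q → L x q ⊎ L (-ᴿ x) q
  ; U = λ q → U x q × U (-ᴿ x) q
  ; L-inhab = let l , Ll = L-inhab x in l , inj₁ Ll
  ; U-inhab = U-max (U-inhab x) (U-inhab (-ᴿ x))
  ; L-down = λ p<q → map⊎ (L-down x p<q) (L-down (-ᴿ x) p<q)
  ; U-up = λ p<q (Up , U-p) → U-up x p<q Up , U-up (-ᴿ x) p<q U-p
  ; L-open = λ
      { (inj₁ Lq) → let r , q<r , Lr = L-open x Lq in r , q<r , inj₁ Lr
      ; (inj₂ Lq) → let r , q<r , Lr = L-open (-ᴿ x) Lq in r , q<r , inj₂ Lr }
  ; U-open = λ (Uq , U-q) → U-max′ (U-open x Uq) (U-open (-ᴿ x) U-q)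
  ; disjoint = λ
      { (inj₁ Lq) (Uq , _) → disjoint x Lq Uq
      ; (inj₂ Lq) (_ , Uq) → disjoint (-ᴿ x) Lq Uq }
  ; located = λ p<q → loc (located x p<q) (located (-ᴿ x) p<q)
  }
  where
  U-≤ : ∀ x {p q} → p ≤ q → U x p → U x q
  U-≤ x {p} {q} p≤q Up = let r , r<p , Ur = U-open x Up in U-up x (<-≤-trans r<p p≤q) Ur
  U-max : ∃ (U x) → ∃ (U (-ᴿ x)) → ∃ λ q → U x q × U (-ᴿ x) q
  U-max (p , Up) (q , Uq) = p ⊔ q , U-≤ x (p≤p⊔q p q) Up , U-≤ (-ᴿ x) (p≤q⊔p p q) Uq
  U-max′ : ∀ {t} → (∃[ p ] p < t × U x p) → (∃[ q ] q < t × U (-ᴿ x) q) →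
           ∃[ r ] r < t × U x r × U (-ᴿ x) r
  U-max′ {t} (p , p<t , Up) (q , q<t , Uq) =
    p ⊔ q , ⊔-lub-< (⊔-sel p q) , U-≤ x (p≤p⊔q p q) Up , U-≤ (-ᴿ x) (p≤q⊔p p q) Uq
    where
    ⊔-lub-< : p ⊔ q ≡ p ⊎ p ⊔ q ≡ q → p ⊔ q < t
    ⊔-lub-< (inj₁ eq) = subst (_< t) (sym eq) p<t
    ⊔-lub-< (inj₂ eq) = subst (_< t) (sym eq) q<t
  loc : ∀ {p q} → L x p ⊎ U x q → L (-ᴿ x) p ⊎ U (-ᴿ x) q →
        (L x p ⊎ L (-ᴿ x) p) ⊎ (U x q × U (-ᴿ x) q)
  loc (inj₁ Lp) _         = inj₁ (inj₁ Lp)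
  loc (inj₂ _)  (inj₁ Lp) = inj₁ (inj₂ Lp)
  loc (inj₂ Uq) (inj₂ U′) = inj₂ (Uq , U′)

posPart negPart : ℤ → ℕ
posPart (+ n)    = n
posPart -[1+ n ] = 0
negPart (+ n)    = 0
negPart -[1+ n ] = suc n

infix 4 _<pow[_,_] _>pow[_,_]

-- For rational c > 0 these say q < c^ρ and c^ρ < q.  Writing ρ = (s - t)/m with
-- s, t the positive and negative parts of the numerator, q < c^ρ is
-- q^m < c^s / c^t whenever q > 0.
_<pow[_,_] : ℚ → ℚ → ℚ → Set
q <pow[ c , ρ ] = q ≤ 0ℚ ⊎ q ^ ↧ₙ ρ * c ^ negPart (↥ ρ) < c ^ posPart (↥ ρ)

_>pow[_,_] : ℚ → ℚ → ℚ → Set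
q >pow[ c , ρ ] = 0ℚ < q × c ^ posPart (↥ ρ) < q ^ ↧ₙ ρ * c ^ negPart (↥ ρ)

below-down : ∀ {p q c} ρ → 0ℚ < c → p ≤ q → q <pow[ c , ρ ] → p <pow[ c , ρ ]
below-down ρ 0<c p≤q (inj₁ q≤0) = inj₁ (≤-trans p≤q q≤0)
below-down {p} {q} {c} ρ 0<c p≤q (inj₂ lt) = go (≤or> p 0ℚ)
  where
  go : p ≤ 0ℚ ⊎ 0ℚ < p → p <pow[ c , ρ ]
  go (inj₁ p≤0) = inj₁ p≤0
  go (inj₂ 0<p) = inj₂ (≤-<-trans
    (*-mono-≤ʳ (<⇒≤ (^-pos (negPart (↥ ρ)) 0<c)) (^-mono-≤ (↧ₙ ρ) 0<p p≤q)) lt)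

above-up : ∀ {p q c} ρ → 0ℚ < c → p ≤ q → p >pow[ c , ρ ] → q >pow[ c , ρ ]
above-up ρ 0<c p≤q (0<p , lt) = <-≤-trans 0<p p≤q ,
  <-≤-trans lt (*-mono-≤ʳ (<⇒≤ (^-pos (negPart (↥ ρ)) 0<c)) (^-mono-≤ (↧ₙ ρ) 0<p p≤q))

below-open : ∀ {q c} ρ → 0ℚ < c → q <pow[ c , ρ ] → ∃[ r ] q < r × r <pow[ c , ρ ]
below-open ρ 0<c below =
  let r , q<r , _ , lt = widen (ℚ.denominator-1 ρ) (^-pos (posPart (↥ ρ)) 0<c) (^-pos (negPart (↥ ρ)) 0<c) below
  in r , q<r , inj₂ lt

above-open : ∀ {q c} ρ → 0ℚ < c → q >pow[ c , ρ ] → ∃[ r ] r < q × r >pow[ c , ρ ]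
above-open ρ 0<c (0<q , lt) =
  let r , r<q , 0<r , lt′ = shrink (↧ₙ ρ) 0<q (^-pos (posPart (↥ ρ)) 0<c) lt
  in r , r<q , 0<r , lt′

above-inhab : ∀ {c} ρ → 0ℚ < c → ∃[ q ] q >pow[ c , ρ ]
above-inhab ρ 0<c = large (ℚ.denominator-1 ρ) (^-pos (posPart (↥ ρ)) 0<c) (^-pos (negPart (↥ ρ)) 0<c)

below? : ∀ {p} c ρ → 0ℚ < p → p <pow[ c , ρ ] ⊎
         c ^ posPart (↥ ρ) ≤ p ^ ↧ₙ ρ * c ^ negPart (↥ ρ)
below? {p} c ρ 0<p = go (≤or> (c ^ posPart (↥ ρ)) (p ^ ↧ₙ ρ * c ^ negPart (↥ ρ)))
  where
  go : _ ⊎ _ → _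
  go (inj₁ ≥) = inj₂ ≥
  go (inj₂ <) = inj₁ (inj₂ <)

rpow-disjoint : ∀ {q c d c′ d′} ρ → 0ℚ < c → 0ℚ < c′ → c < d′ → c′ < d →
  q <pow[ c , ρ ] → q <pow[ d , ρ ] → q >pow[ c′ , ρ ] → q >pow[ d′ , ρ ] → ⊥
rpow-disjoint ρ _ _ _ _ (inj₁ q≤0) _ (0<q , _) _ = <-irrefl refl (<-≤-trans 0<q q≤0)
rpow-disjoint ρ _ _ _ _ (inj₂ _) (inj₁ q≤0) (0<q , _) _ = <-irrefl refl (<-≤-trans 0<q q≤0)
rpow-disjoint {q} {c} {d} {c′} {d′} ρ 0<c 0<c′ c<d′ c′<d (inj₂ c-below) (inj₂ d-below) (0<q , c′-above) (_ , d′-above) =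
  go (↥ ρ) (↧ₙ ρ) c-below d-below c′-above d′-above
  where
  go : ∀ n m → q ^ m * c ^ negPart n < c ^ posPart n → q ^ m * d ^ negPart n < d ^ posPart n →
       c′ ^ posPart n < q ^ m * c′ ^ negPart n → d′ ^ posPart n < q ^ m * d′ ^ negPart n → ⊥
  go (+ k) m lt _ _ gt = <-irrefl refl (<-trans lt (≤-<-trans (^-mono-≤ k 0<c (<⇒≤ c<d′)) gt))
  go -[1+ k ] m _ lt gt _ = <-irrefl refl (<-trans gt (≤-<-trans
    (*-mono-≤ˡ (<⇒≤ (^-pos m 0<q)) (^-mono-≤ (suc k) 0<c′ (<⇒≤ c′<d))) lt))

rpow-compare : ∀ {p q g e e′} ρ → 0ℚ < p → p < q → p * g ^ ℤ.∣ ↥ ρ ∣ < q →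
  0ℚ < g → 0ℚ < e → 0ℚ < e′ → e ≤ g * e′ → e′ ≤ g * e →
  e ^ posPart (↥ ρ) ≤ p ^ ↧ₙ ρ * e ^ negPart (↥ ρ) → q >pow[ e′ , ρ ]
rpow-compare {p} {q} {g} {e} {e′} ρ 0<p p<q pg<q 0<g 0<e 0<e′ e≤ge′ e′≤ge ≤p =
  0<q , go (↥ ρ) (ℚ.denominator-1 ρ) pg<q ≤p
  where
  0<q : 0ℚ < q
  0<q = <-trans 0<p p<q
  grow : ∀ {e e′} k → 0ℚ < e → e ≤ g * e′ → e ^ k ≤ g ^ k * e′ ^ k
  grow {e} {e′} k 0<e e≤ge′ = ≤-trans (^-mono-≤ k 0<e e≤ge′) (≤-reflexive (^-distrib-* g e′ k))
  absorb : ∀ m k → p * g ^ k < q → p ^ suc m * g ^ k < q ^ suc m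
  absorb m k lt = subst (_< q ^ suc m) (*-swap p (g ^ k) (p ^ m))
    (<-≤-trans (*-mono-<ʳ (^-pos m 0<p) lt) (*-mono-≤ˡ (<⇒≤ 0<q) (^-mono-≤ m 0<p (<⇒≤ p<q))))
  go : ∀ n m → p * g ^ ℤ.∣ n ∣ < q → e ^ posPart n ≤ p ^ suc m * e ^ negPart n →
       e′ ^ posPart n < q ^ suc m * e′ ^ negPart n
  go (+ k) m lt ≤p = subst (e′ ^ k <_) (sym (*-identityʳ (q ^ suc m)))
    (≤-<-trans (grow k 0<e′ e′≤ge)
      (≤-<-trans (*-mono-≤ˡ (<⇒≤ (^-pos k 0<g)) (≤-trans ≤p (≤-reflexive (*-identityʳ (p ^ suc m)))))
        (subst (_< q ^ suc m) (*-comm (p ^ suc m) (g ^ k)) (absorb m k lt))))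
  go -[1+ k ] m lt ≤p = ≤-<-trans ≤p (≤-<-trans
    (*-mono-≤ˡ (<⇒≤ (^-pos (suc m) 0<p)) (grow (suc k) 0<e e≤ge′))
    (subst (_< q ^ suc m * e′ ^ suc k) (*-assoc (p ^ suc m) (g ^ suc k) (e′ ^ suc k))
      (*-mono-<ʳ (^-pos (suc k) 0<e′) (absorb m (suc k) lt))))

ℝ⁺ : Set₁
ℝ⁺ = Σ ℝ (0ᴿ <ᴿ_)

infixr 8 _^ℚ_ _^ᴿ_

-- u ↦ u^ρ is monotone on (0,∞), so on a rational interval (c,d) around z it lies
-- between its values at c and d; which of the two is the smaller one
-- depends on the sign of ρ, hence the symmetric conditions.
rpow : ℚ → ℝ⁺ → ℝ
rpow ρ (z , c₀ , 0<c₀ , Lc₀) = record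
  { L = Lower ; U = Upper
  ; L-inhab = 0ℚ , c₀ , proj₁ (U-inhab z) , 0<c₀ , Lc₀ , proj₂ (U-inhab z) , inj₁ ≤-refl , inj₁ ≤-refl
  ; U-inhab =
      let d , Ud = U-inhab z
          q , q> = above-inhab ρ 0<c₀
          r , r> = above-inhab ρ (<-trans 0<c₀ (L<U z Lc₀ Ud))
      in upper 0<c₀ Lc₀ Ud q> r> (≤-total q r)
  ; L-down = λ p<q (c , d , 0<c , Lc , Ud , c< , d<) → c , d , 0<c , Lc , Ud ,
      below-down ρ 0<c (<⇒≤ p<q) c< , below-down ρ (<-trans 0<c (L<U z Lc Ud)) (<⇒≤ p<q) d<
  ; U-up = λ p<q (c , d , 0<c , Lc , Ud , c> , d>) → c , d , 0<c , Lc , Ud ,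
      above-up ρ 0<c (<⇒≤ p<q) c> , above-up ρ (<-trans 0<c (L<U z Lc Ud)) (<⇒≤ p<q) d>
  ; L-open = λ (c , d , 0<c , Lc , Ud , c< , d<) →
      lower-open 0<c Lc Ud (below-open ρ 0<c c<) (below-open ρ (<-trans 0<c (L<U z Lc Ud)) d<)
  ; U-open = λ (c , d , 0<c , Lc , Ud , c> , d>) →
      upper-open 0<c Lc Ud (above-open ρ 0<c c>) (above-open ρ (<-trans 0<c (L<U z Lc Ud)) d>)
  ; disjoint = λ (c , d , 0<c , Lc , Ud , c< , d<) (c′ , d′ , 0<c′ , Lc′ , Ud′ , c′> , d′>) →
      rpow-disjoint ρ 0<c 0<c′ (L<U z Lc Ud′) (L<U z Lc′ Ud) c< d< c′> d′>
  ; located = λ {p} p<q → loc p<q (≤or> p 0ℚ)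
  }
  where
  Lower Upper : ℚ → Set
  Lower q = ∃₂ λ c d → 0ℚ < c × L z c × U z d × q <pow[ c , ρ ] × q <pow[ d , ρ ]
  Upper q = ∃₂ λ c d → 0ℚ < c × L z c × U z d × q >pow[ c , ρ ] × q >pow[ d , ρ ]

  upper : ∀ {c d q r} → 0ℚ < c → L z c → U z d → q >pow[ c , ρ ] → r >pow[ d , ρ ] →
          q ≤ r ⊎ r ≤ q → ∃ Upper
  upper {c} {d} {q} {r} 0<c Lc Ud q> r> (inj₁ q≤r) = r , c , d , 0<c , Lc , Ud , above-up ρ 0<c q≤r q> , r>
  upper {c} {d} {q} {r} 0<c Lc Ud q> r> (inj₂ r≤q) =
    q , c , d , 0<c , Lc , Ud , q> , above-up ρ (<-trans 0<c (L<U z Lc Ud)) r≤q r>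

  lower-open : ∀ {c d q} → 0ℚ < c → L z c → U z d → (∃[ r ] q < r × r <pow[ c , ρ ]) →
               (∃[ r ] q < r × r <pow[ d , ρ ]) → ∃[ r ] q < r × Lower r
  lower-open {c} {d} {q} 0<c Lc Ud (r , q<r , r<) (s , q<s , s<) = go (≤-total r s)
    where
    go : r ≤ s ⊎ s ≤ r → ∃[ r ] q < r × Lower r
    go (inj₁ r≤s) = r , q<r , c , d , 0<c , Lc , Ud , r< , below-down ρ (<-trans 0<c (L<U z Lc Ud)) r≤s s<
    go (inj₂ s≤r) = s , q<s , c , d , 0<c , Lc , Ud , below-down ρ 0<c s≤r r< , s<

  upper-open : ∀ {c d q} → 0ℚ < c → L z c → U z d → (∃[ r ] r < q × r >pow[ c , ρ ]) →
               (∃[ r ] r < q × r >pow[ d , ρ ]) → ∃[ r ] r < q × Upper r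
  upper-open {c} {d} {q} 0<c Lc Ud (r , r<q , r>) (s , s<q , s>) = go (≤-total r s)
    where
    go : r ≤ s ⊎ s ≤ r → ∃[ r ] r < q × Upper r
    go (inj₁ r≤s) = s , s<q , c , d , 0<c , Lc , Ud , above-up ρ 0<c r≤s r> , s>
    go (inj₂ s≤r) = r , r<q , c , d , 0<c , Lc , Ud , r> , above-up ρ (<-trans 0<c (L<U z Lc Ud)) s≤r s>

  bracket : ∀ {g} → 1ℚ < g → ∃₂ λ c d → 0ℚ < c × L z c × U z d × d ≤ g * c
  bracket {g} 1<g = pick (approximate z (*-pos 0<g-1 0<c₀))
    where
    0<g-1 : 0ℚ < g - 1ℚ
    0<g-1 = +-monoˡ-< (- 1ℚ) 1<g
    collect : ∀ c g → c + (g - 1ℚ) * c ≡ g * c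
    collect = solve 2 (λ c g → c :+ (g :+ :- con 1ℚ) :* c := g :* c) refl
    pick : (∃₂ λ c d → L z c × U z d × d < c + (g - 1ℚ) * c₀) → _
    pick (c , d , Lc , Ud , d<) = go (≤-total c c₀)
      where
      go : c ≤ c₀ ⊎ c₀ ≤ c → _
      go (inj₁ c≤c₀) = c₀ , d , 0<c₀ , Lc₀ , Ud ,
        ≤-trans (<⇒≤ d<) (≤-trans (+-monoˡ-≤ ((g - 1ℚ) * c₀) c≤c₀) (≤-reflexive (collect c₀ g)))
      go (inj₂ c₀≤c) = c , d , <-≤-trans 0<c₀ c₀≤c , Lc , Ud ,
        ≤-trans (<⇒≤ d<) (≤-trans (+-monoʳ-≤ c (*-mono-≤ˡ (<⇒≤ 0<g-1) c₀≤c)) (≤-reflexive (collect c g)))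

  loc : ∀ {p q} → p < q → p ≤ 0ℚ ⊎ 0ℚ < p → Lower p ⊎ Upper q
  loc p<q (inj₁ p≤0) = inj₁ (c₀ , proj₁ (U-inhab z) , 0<c₀ , Lc₀ , proj₂ (U-inhab z) , inj₁ p≤0 , inj₁ p≤0)
  loc {p} {q} p<q (inj₂ 0<p) = choose (slack ℤ.∣ ↥ ρ ∣ 0<p p<q)
    where
    choose : (∃[ g ] 1ℚ < g × p * g ^ ℤ.∣ ↥ ρ ∣ < q) → Lower p ⊎ Upper q
    choose (g , 1<g , pg<q) = go (bracket 1<g)
      where
      0<g : 0ℚ < g
      0<g = <-trans 0<1 1<g
      ≤g* : ∀ {c} → 0ℚ < c → c ≤ g * c
      ≤g* {c} 0<c = subst (_≤ g * c) (*-identityˡ c) (*-mono-≤ʳ (<⇒≤ 0<c) (<⇒≤ 1<g))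
      go : (∃₂ λ c d → 0ℚ < c × L z c × U z d × d ≤ g * c) → Lower p ⊎ Upper q
      go (c , d , 0<c , Lc , Ud , d≤gc) = decide (below? c ρ 0<p) (below? d ρ 0<p)
        where
        0<d : 0ℚ < d
        0<d = <-trans 0<c (L<U z Lc Ud)
        c≤gd : c ≤ g * d
        c≤gd = ≤-trans (<⇒≤ (L<U z Lc Ud)) (≤g* 0<d)
        decide : _ ⊎ _ → _ ⊎ _ → Lower p ⊎ Upper q
        decide (inj₁ c<) (inj₁ d<) = inj₁ (c , d , 0<c , Lc , Ud , c< , d<)
        decide (inj₂ c≥) _ = inj₂ (c , d , 0<c , Lc , Ud ,
          rpow-compare ρ 0<p p<q pg<q 0<g 0<c 0<c (≤g* 0<c) (≤g* 0<c) c≥ ,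
          rpow-compare ρ 0<p p<q pg<q 0<g 0<c 0<d c≤gd d≤gc c≥)
        decide (inj₁ _) (inj₂ d≥) = inj₂ (c , d , 0<c , Lc , Ud ,
          rpow-compare ρ 0<p p<q pg<q 0<g 0<d 0<c d≤gc c≤gd d≥ ,
          rpow-compare ρ 0<p p<q pg<q 0<g 0<d 0<d (≤g* 0<d) (≤g* 0<d) d≥)

rpow-pos : ∀ ρ z → 0ᴿ <ᴿ rpow ρ z
rpow-pos ρ z = L-open (rpow ρ z) (proj₂ (L-inhab (rpow ρ z)))

_^ℚ_ : ℝ⁺ → ℚ → ℝ⁺
z ^ℚ ρ = rpow ρ z , rpow-pos ρ z

parts : ∀ n k → n ℤ.* + k ℤ.+ + (negPart n ℕ.* k) ≡ + (posPart n ℕ.* k)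
parts (+ n) k = trans (ℤₚ.+-identityʳ (+ n ℤ.* + k)) (sym (ℤₚ.pos-* n k))
parts -[1+ n ] k = trans (cong (ℤ._+_ (-[1+ n ] ℤ.* + k)) (ℤₚ.pos-* (suc n) k))
  (trans (sym (ℤₚ.*-distribʳ-+ (+ k) -[1+ n ] (+ suc n)))
    (cong (ℤ._* + k) (ℤₚ.+-inverseˡ (+ suc n))))

cross : ℚ → ℚ → ℕ
cross r s = posPart (↥ r) ℕ.* ↧ₙ s ℕ.+ negPart (↥ s) ℕ.* ↧ₙ r

crossᶻ : ∀ r s → + cross r s ≡ ↥ r ℤ.* ↧ s ℤ.+ + (negPart (↥ r) ℕ.* ↧ₙ s ℕ.+ negPart (↥ s) ℕ.* ↧ₙ r)
crossᶻ r s = trans (ℤₚ.pos-+ (posPart (↥ r) ℕ.* ↧ₙ s) (negPart (↥ s) ℕ.* ↧ₙ r))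
  (trans (cong (ℤ._+ + (negPart (↥ s) ℕ.* ↧ₙ r)) (sym (parts (↥ r) (↧ₙ s))))
    (trans (ℤₚ.+-assoc (↥ r ℤ.* ↧ s) (+ (negPart (↥ r) ℕ.* ↧ₙ s)) (+ (negPart (↥ s) ℕ.* ↧ₙ r)))
      (cong (ℤ._+_ (↥ r ℤ.* ↧ s)) (sym (ℤₚ.pos-+ (negPart (↥ r) ℕ.* ↧ₙ s) (negPart (↥ s) ℕ.* ↧ₙ r))))))

crossᶻ′ : ∀ r s → + cross s r ≡ ↥ s ℤ.* ↧ r ℤ.+ + (negPart (↥ r) ℕ.* ↧ₙ s ℕ.+ negPart (↥ s) ℕ.* ↧ₙ r)
crossᶻ′ r s = trans (crossᶻ s r)
  (cong (λ k → ↥ s ℤ.* ↧ r ℤ.+ + k) (ℕₚ.+-comm (negPart (↥ s) ℕ.* ↧ₙ r) (negPart (↥ r) ℕ.* ↧ₙ s)))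

cross-mono : ∀ {r s} → r < s → cross r s ℕ.< cross s r
cross-mono {r} {s} r<s = ℤₚ.drop‿+<+ (subst₂ ℤ._<_ (sym (crossᶻ r s)) (sym (crossᶻ′ r s))
  (ℤₚ.+-monoˡ-< (+ (negPart (↥ r) ℕ.* ↧ₙ s ℕ.+ negPart (↥ s) ℕ.* ↧ₙ r)) (drop-*<* r<s)))

cross-close : ∀ {r s} M → s < r + (+ 1 / suc M) →
  cross s r ℕ.* suc M ℕ.< cross r s ℕ.* suc M ℕ.+ ↧ₙ r ℕ.* ↧ₙ s
cross-close {r} {s} M s<r+ = ℤₚ.drop‿+<+ (subst₂ ℤ._<_ (sym lhs) (sym rhs)
  (ℤₚ.+-monoˡ-< (E ℤ.* + suc M) core))
  where
  E : ℤ
  E = + (negPart (↥ r) ℕ.* ↧ₙ s ℕ.+ negPart (↥ s) ℕ.* ↧ₙ r)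
  ε : ℚᵘ.ℚᵘ
  ε = ℚᵘ.mkℚᵘ (+ 1) M
  unnormalised : toℚᵘ s ℚᵘ.< toℚᵘ r ℚᵘ.+ ε
  unnormalised = ℚᵘₚ.<-respʳ-≃
    (ℚᵘₚ.≃-trans (toℚᵘ-homo-+ r (+ 1 / suc M)) (ℚᵘₚ.+-congʳ (toℚᵘ r) (toℚᵘ-fromℚᵘ ε)))
    (toℚᵘ-mono-< s<r+)
  plain : ∀ r s → toℚᵘ s ℚᵘ.< toℚᵘ r ℚᵘ.+ ε →
    ↥ s ℤ.* (↧ r ℤ.* + suc M) ℤ.< (↥ r ℤ.* + suc M ℤ.+ + 1 ℤ.* ↧ r) ℤ.* ↧ s
  plain r@record{} s@record{} (ℚᵘ.*<* lt) =
    subst (ℤ._< (↥ r ℤ.* + suc M ℤ.+ + 1 ℤ.* ↧ r) ℤ.* ↧ s)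
      (cong (ℤ._*_ (↥ s)) (ℤₚ.pos-* (↧ₙ r) (suc M))) lt
  rearrange : ∀ n m M m′ → (n ℤ.* M ℤ.+ + 1 ℤ.* m) ℤ.* m′ ≡ n ℤ.* m′ ℤ.* M ℤ.+ m ℤ.* m′
  rearrange = ℤsolve 4 (λ n m M m′ → (n ⊗ M ⊕ ℤcon (+ 1) ⊗ m) ⊗ m′ ⊜ n ⊗ m′ ⊗ M ⊕ m ⊗ m′) refl
  core : ↥ s ℤ.* ↧ r ℤ.* + suc M ℤ.< ↥ r ℤ.* ↧ s ℤ.* + suc M ℤ.+ ↧ r ℤ.* ↧ s
  core = subst₂ ℤ._<_ (sym (ℤₚ.*-assoc (↥ s) (↧ r) (+ suc M)))
    (rearrange (↥ r) (↧ r) (+ suc M) (↧ s)) (plain r s unnormalised)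
  lhs : + (cross s r ℕ.* suc M) ≡ ↥ s ℤ.* ↧ r ℤ.* + suc M ℤ.+ E ℤ.* + suc M
  lhs = trans (ℤₚ.pos-* (cross s r) (suc M))
    (trans (cong (ℤ._* + suc M) (crossᶻ′ r s)) (ℤₚ.*-distribʳ-+ (+ suc M) (↥ s ℤ.* ↧ r) E))
  move : ∀ a M E b → (a ℤ.+ E) ℤ.* M ℤ.+ b ≡ a ℤ.* M ℤ.+ b ℤ.+ E ℤ.* M
  move = ℤsolve 4 (λ a M E b → (a ⊕ E) ⊗ M ⊕ b ⊜ a ⊗ M ⊕ b ⊕ E ⊗ M) refl
  rhs : + (cross r s ℕ.* suc M ℕ.+ ↧ₙ r ℕ.* ↧ₙ s) ≡
        ↥ r ℤ.* ↧ s ℤ.* + suc M ℤ.+ ↧ r ℤ.* ↧ s ℤ.+ E ℤ.* + suc M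
  rhs = trans (ℤₚ.pos-+ (cross r s ℕ.* suc M) (↧ₙ r ℕ.* ↧ₙ s))
    (trans (cong₂ ℤ._+_ (trans (ℤₚ.pos-* (cross r s) (suc M)) (cong (ℤ._* + suc M) (crossᶻ r s)))
                        (ℤₚ.pos-* (↧ₙ r) (↧ₙ s)))
      (move (↥ r ℤ.* ↧ s) (+ suc M) E (↧ r ℤ.* ↧ s)))

module _ {X : ℚ} (1≤X : 1ℚ ≤ X) where

  0<X : 0ℚ < X
  0<X = <-≤-trans 0<1 1≤X

  split : ∀ r s → X ^ cross r s ≡ (X ^ posPart (↥ r)) ^ ↧ₙ s * (X ^ negPart (↥ s)) ^ ↧ₙ r
  split r s = trans (^-homo-* X (posPart (↥ r) ℕ.* ↧ₙ s) (negPart (↥ s) ℕ.* ↧ₙ r))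
    (cong₂ _*_ (sym (^-assocʳ X (posPart (↥ r)) (↧ₙ s))) (sym (^-assocʳ X (negPart (↥ s)) (↧ₙ r))))

  powers : ∀ q r s → q ^ (↧ₙ r ℕ.* ↧ₙ s) * (X ^ negPart (↥ r)) ^ ↧ₙ s ≡
                     (q ^ ↧ₙ r * X ^ negPart (↥ r)) ^ ↧ₙ s
  powers q r s = trans (cong (_* (X ^ negPart (↥ r)) ^ ↧ₙ s) (sym (^-assocʳ q (↧ₙ r) (↧ₙ s))))
    (sym (^-distrib-* (q ^ ↧ₙ r) (X ^ negPart (↥ r)) (↧ₙ s)))

  exp-disjoint : ∀ {q r s} → r < s → q <pow[ X , r ] → q >pow[ X , s ] → ⊥
  exp-disjoint _ (inj₁ q≤0) (0<q , _) = <-irrefl refl (<-≤-trans 0<q q≤0)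
  exp-disjoint {q} {r} {s} r<s (inj₂ lt) (0<q , gt) = <-irrefl refl (begin-strict
    K * (Nʳ * Nˢ)      ≡⟨ sym (*-assoc K Nʳ Nˢ) ⟩
    K * Nʳ * Nˢ        <⟨ *-mono-<ʳ 0<Nˢ lt′ ⟩
    Pʳ * Nˢ            ≡⟨ sym (split r s) ⟩
    X ^ cross r s      ≤⟨ ^-monoʳ-≤ 1≤X (ℕₚ.<⇒≤ (cross-mono {r} {s} r<s)) ⟩
    X ^ cross s r      ≡⟨ split s r ⟩
    Pˢ * Nʳ            <⟨ *-mono-<ʳ 0<Nʳ gt′ ⟩
    K * Nˢ * Nʳ        ≡⟨ trans (*-assoc K Nˢ Nʳ) (cong (K *_) (*-comm Nˢ Nʳ)) ⟩
    K * (Nʳ * Nˢ)      ∎)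
    where
    open ≤-Reasoning
    K Nʳ Nˢ Pʳ Pˢ : ℚ
    K = q ^ (↧ₙ r ℕ.* ↧ₙ s)
    Nʳ = (X ^ negPart (↥ r)) ^ ↧ₙ s
    Nˢ = (X ^ negPart (↥ s)) ^ ↧ₙ r
    Pʳ = (X ^ posPart (↥ r)) ^ ↧ₙ s
    Pˢ = (X ^ posPart (↥ s)) ^ ↧ₙ r
    0<Nʳ : 0ℚ < Nʳ
    0<Nʳ = ^-pos (↧ₙ s) (^-pos (negPart (↥ r)) 0<X)
    0<Nˢ : 0ℚ < Nˢ
    0<Nˢ = ^-pos (↧ₙ r) (^-pos (negPart (↥ s)) 0<X)
    lt′ : K * Nʳ < Pʳ
    lt′ = subst (_< Pʳ) (sym (powers q r s))
      (^-mono-< (ℚ.denominator-1 s) (*-pos (^-pos (↧ₙ r) 0<q) (^-pos (negPart (↥ r)) 0<X)) lt)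
    gt′ : Pˢ < K * Nˢ
    gt′ = subst (Pˢ <_) (trans (sym (powers q s r))
        (cong (λ k → q ^ k * Nˢ) (ℕₚ.*-comm (↧ₙ s) (↧ₙ r))))
      (^-mono-< (ℚ.denominator-1 r) (^-pos (posPart (↥ s)) 0<X) gt)

  gap : ∀ {p q A B K} M → 0ℚ < p → p < q → p ^ M * X < q ^ M → A ℕ.< B →
        B ℕ.* M ℕ.≤ A ℕ.* M ℕ.+ K → p ^ K * X ^ B < q ^ K * X ^ A
  gap {p} {q} {A} {B} {K} M 0<p p<q pX<q A<B close = begin-strict
    p ^ K * X ^ B               ≡⟨ cong₂ (λ k b → p ^ k * X ^ b) (sym K≡) (sym B≡) ⟩
    p ^ (e ℕ.+ j) * X ^ (D ℕ.+ A) ≡⟨ cong₂ _*_ (^-homo-* p e j) (^-homo-* X D A) ⟩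
    p ^ e * p ^ j * (X ^ D * X ^ A) ≡⟨ shuffle (p ^ e) (p ^ j) (X ^ D) (X ^ A) ⟩
    p ^ e * X ^ D * (p ^ j * X ^ A) <⟨ *-mono-<ʳ (*-pos (^-pos j 0<p) (^-pos A 0<X)) main ⟩
    q ^ e * (p ^ j * X ^ A)     ≤⟨ *-mono-≤ˡ (<⇒≤ (^-pos e 0<q))
                                     (*-mono-≤ʳ (<⇒≤ (^-pos A 0<X)) (^-mono-≤ j 0<p (<⇒≤ p<q))) ⟩
    q ^ e * (q ^ j * X ^ A)     ≡⟨ sym (*-assoc (q ^ e) (q ^ j) (X ^ A)) ⟩
    q ^ e * q ^ j * X ^ A       ≡⟨ cong (_* X ^ A) (sym (^-homo-* q e j)) ⟩
    q ^ (e ℕ.+ j) * X ^ A       ≡⟨ cong (λ k → q ^ k * X ^ A) K≡ ⟩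
    q ^ K * X ^ A               ∎
    where
    open ≤-Reasoning
    0<q : 0ℚ < q
    0<q = <-trans 0<p p<q
    D-1 D e j : ℕ
    D-1 = B ℕ.∸ suc A
    D = suc D-1
    e = M ℕ.* D
    j = K ℕ.∸ e
    B≡ : D ℕ.+ A ≡ B
    B≡ = trans (sym (ℕₚ.+-suc D-1 A)) (ℕₚ.m∸n+n≡m A<B)
    e≤K : e ℕ.≤ K
    e≤K = ℕₚ.+-cancelˡ-≤ (A ℕ.* M) e K (subst (ℕ._≤ A ℕ.* M ℕ.+ K)
      (trans (cong (ℕ._* M) (sym B≡)) (trans (ℕₚ.*-distribʳ-+ M D A)
        (trans (ℕₚ.+-comm (D ℕ.* M) (A ℕ.* M)) (cong (ℕ._+_ (A ℕ.* M)) (ℕₚ.*-comm D M))))) close)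
    K≡ : e ℕ.+ j ≡ K
    K≡ = ℕₚ.m+[n∸m]≡n e≤K
    shuffle : ∀ a b c d → a * b * (c * d) ≡ a * c * (b * d)
    shuffle = solve 4 (λ a b c d → a :* b :* (c :* d) := a :* c :* (b :* d)) refl
    main : p ^ e * X ^ D < q ^ e
    main = subst₂ _<_
      (trans (^-distrib-* (p ^ M) X D) (cong (_* X ^ D) (^-assocʳ p M D)))
      (^-assocʳ q M D)
      (^-mono-< D-1 (*-pos (^-pos M 0<p) 0<X) pX<q)

  exp-compare : ∀ {p q r s} M → 0ℚ < p → p < q → p ^ suc M * X < q ^ suc M →
    r < s → s < r + (+ 1 / suc M) →
    X ^ posPart (↥ r) ≤ p ^ ↧ₙ r * X ^ negPart (↥ r) → q >pow[ X , s ]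
  exp-compare {p} {q} {r} {s} M 0<p p<q pX<q r<s s<r+ ≤p = 0<q ,
    ^-cancel-< (↧ₙ r) (*-pos (^-pos (↧ₙ s) 0<q) (^-pos (negPart (↥ s)) 0<X))
      (subst (Pˢ <_) (trans (cong (λ k → q ^ k * Nˢ) (ℕₚ.*-comm (↧ₙ r) (↧ₙ s))) (powers q s r))
        (*-cancel-<ʳ (*-pos 0<Nʳ (^-pos (↧ₙ r ℕ.* ↧ₙ s) 0<p)) chain))
    where
    open ≤-Reasoning
    0<q : 0ℚ < q
    0<q = <-trans 0<p p<q
    Kp Kq Nʳ Nˢ Pʳ Pˢ : ℚ
    Kp = p ^ (↧ₙ r ℕ.* ↧ₙ s)
    Kq = q ^ (↧ₙ r ℕ.* ↧ₙ s)
    Nʳ = (X ^ negPart (↥ r)) ^ ↧ₙ s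
    Nˢ = (X ^ negPart (↥ s)) ^ ↧ₙ r
    Pʳ = (X ^ posPart (↥ r)) ^ ↧ₙ s
    Pˢ = (X ^ posPart (↥ s)) ^ ↧ₙ r
    0<Nʳ : 0ℚ < Nʳ
    0<Nʳ = ^-pos (↧ₙ s) (^-pos (negPart (↥ r)) 0<X)
    0<Nˢ : 0ℚ < Nˢ
    0<Nˢ = ^-pos (↧ₙ r) (^-pos (negPart (↥ s)) 0<X)
    ≤p′ : Pʳ ≤ Kp * Nʳ
    ≤p′ = subst (Pʳ ≤_) (sym (powers p r s)) (^-mono-≤ (↧ₙ s) (^-pos (posPart (↥ r)) 0<X) ≤p)
    front : ∀ a b c → a * (b * c) ≡ c * (a * b)
    front = solve 3 (λ a b c → a :* (b :* c) := c :* (a :* b)) refl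
    back : ∀ k a b c → k * (a * b * c) ≡ k * c * (b * a)
    back = solve 4 (λ k a b c → k :* (a :* b :* c) := k :* c :* (b :* a)) refl
    chain : Pˢ * (Nʳ * Kp) < Kq * Nˢ * (Nʳ * Kp)
    chain = begin-strict
      Pˢ * (Nʳ * Kp)        ≡⟨ front Pˢ Nʳ Kp ⟩
      Kp * (Pˢ * Nʳ)        ≡⟨ cong (Kp *_) (sym (split s r)) ⟩
      Kp * X ^ cross s r    <⟨ gap {A = cross r s} {cross s r} (suc M) 0<p p<q pX<q
                                 (cross-mono {r} {s} r<s) (ℕₚ.<⇒≤ (cross-close {r} {s} M s<r+)) ⟩
      Kq * X ^ cross r s    ≡⟨ cong (Kq *_) (split r s) ⟩
      Kq * (Pʳ * Nˢ)        ≤⟨ *-mono-≤ˡ (<⇒≤ (^-pos (↧ₙ r ℕ.* ↧ₙ s) 0<q)) (*-mono-≤ʳ (<⇒≤ 0<Nˢ) ≤p′) ⟩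
      Kq * (Kp * Nʳ * Nˢ)   ≡⟨ back Kq Kp Nʳ Nˢ ⟩
      Kq * Nˢ * (Nʳ * Kp)   ∎

  -- X^y as the supremum of the X^r with rational r < y, using 1 ≤ X.
  expᴿ : ℝ → ℝ
  expᴿ y = record
    { L = Lower ; U = Upper
    ; L-inhab = let r , Lr = L-inhab y in 0ℚ , r , Lr , inj₁ ≤-refl
    ; U-inhab = let s , Us = U-inhab y ; q , q> = above-inhab s 0<X in q , s , Us , q>
    ; L-down = λ p<q (r , Lr , q<) → r , Lr , below-down r 0<X (<⇒≤ p<q) q<
    ; U-up = λ p<q (s , Us , p>) → s , Us , above-up s 0<X (<⇒≤ p<q) p>
    ; L-open = λ (r , Lr , q<) → let t , q<t , t< = below-open r 0<X q< in t , q<t , r , Lr , t<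
    ; U-open = λ (s , Us , q>) → let t , t<q , t> = above-open s 0<X q> in t , t<q , s , Us , t>
    ; disjoint = λ (r , Lr , q<) (s , Us , q>) → exp-disjoint (L<U y Lr Us) q< q>
    ; located = λ {p} p<q → loc p<q (≤or> p 0ℚ)
    }
    where
    Lower Upper : ℚ → Set
    Lower q = ∃[ r ] L y r × q <pow[ X , r ]
    Upper q = ∃[ s ] U y s × q >pow[ X , s ]

    exponent : ∀ {p q} → 0ℚ < p → p < q → ∃[ M ] p ^ suc M * X < q ^ suc M
    exponent {p} {q} 0<p p<q = go (quotient 0<p (<-trans 0<p p<q))
      where
      go : (∃[ h ] 0ℚ < h × h * p ≡ q) → _
      go (h , 0<h , hp≡q) = go′ (exceeds X 1<h)
        where
        1<h : 1ℚ < h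
        1<h = *-cancel-<ʳ 0<p (subst₂ _<_ (sym (*-identityˡ p)) (sym hp≡q) p<q)
        go′ : (∃[ n ] X < h ^ n) → _
        go′ (n , X<) = n , subst (p ^ suc n * X <_)
          (trans (*-comm (p ^ suc n) (h ^ suc n))
            (trans (sym (^-distrib-* h p (suc n))) (cong (_^ suc n) hp≡q)))
          (*-mono-<ˡ (^-pos (suc n) 0<p) (<-≤-trans X< (^-monoʳ-≤ (<⇒≤ 1<h) (ℕₚ.n≤1+n n))))

    loc : ∀ {p q} → p < q → p ≤ 0ℚ ⊎ 0ℚ < p → Lower p ⊎ Upper q
    loc p<q (inj₁ p≤0) = inj₁ (proj₁ (L-inhab y) , proj₂ (L-inhab y) , inj₁ p≤0)
    loc {p} {q} p<q (inj₂ 0<p) = go (exponent 0<p p<q)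
      where
      go : (∃[ M ] p ^ suc M * X < q ^ suc M) → Lower p ⊎ Upper q
      go (M , pX<q) = go′ (approximate y (positive⁻¹ (+ 1 / suc M) {{normalize-pos 1 (suc M)}}))
        where
        go′ : (∃₂ λ r s → L y r × U y s × s < r + (+ 1 / suc M)) → Lower p ⊎ Upper q
        go′ (r , s , Lr , Us , s<r+) = decide (below? X r 0<p)
          where
          decide : _ ⊎ _ → Lower p ⊎ Upper q
          decide (inj₁ p<) = inj₁ (r , Lr , p<)
          decide (inj₂ p≥) = inj₂ (s , Us , exp-compare {r = r} {s} M 0<p p<q pX<q (L<U y Lr Us) s<r+ p≥)

1≤ι : ∀ x .{{_ : ℕ.NonZero x}} → 1ℚ ≤ ι x
1≤ι (suc n) = subst₂ _≤_ (+-identityʳ 1ℚ) (sym (ι-suc n))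
  (+-monoʳ-≤ 1ℚ (nonNegative⁻¹ (ι n) {{normalize-nonNeg n 1}}))

_^ᴿ_ : (x : ℕ) .{{_ : ℕ.NonZero x}} → ℝ → ℝ
x ^ᴿ y = expᴿ (1≤ι x) y

infixl 7 _÷ᶻ_

_÷ᶻ_ : (a b : ℤ) .{{_ : ℤ.NonZero b}} → ℚ
a ÷ᶻ b = ((ℤ.sign b ℤ.◃ 1) ℤ.* a) / ℤ.∣ b ∣

f : (a b : ℤ) .{{_ : ℤ.NonZero a}} .{{_ : ℤ.NonZero b}} → ℝ⁺ → ℝ⁺
f a b z = z ^ℚ (a ÷ᶻ b)

-- Irrationality is meant in the positive sense, apartness from every rational.
Irrational : ℝ → Set
Irrational ζ = ∀ q → ζ #ᴿ fromℚ q

InfinitelyMany : Pred ℚ 0ℓ → Set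
InfinitelyMany P = ∀ (qs : List ℚ) → ∃[ q ] q ∉ qs × P q

-- q = y/x with x ≥ 1, not necessarily in lowest terms, and |ζ - y/x| ≤ x^(-η).
Approximant : ℝ → ℝ → ℚ → Set
Approximant ζ η q =
  Σ[ y ∈ ℤ ] Σ[ x ∈ ℕ ] Σ[ x≢0 ∈ ℕ.NonZero x ] let instance nz = x≢0 in
    q ≡ y / x × ∣ ζ -ᴿ fromℚ q ∣ᴿ ≤ᴿ x ^ᴿ (-ᴿ η)

Liouville : ℝ → Set₁
Liouville ζ = Irrational ζ × (∀ η → 0ᴿ <ᴿ η → InfinitelyMany (Approximant ζ η))

-- Uncountability in the positive form: every sequence of reals misses an element
-- of P, where missing means being apart from all its terms.  It entails
-- non-countability (uncountable⇒¬countable) and classically is equivalent to it.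
UncountablyMany : ∀ {ℓ} → Pred ℝ ℓ → Set (lsuc 0ℓ ⊔ˡ ℓ)
UncountablyMany P = ∀ (s : ℕ → ℝ) → ∃[ ζ ] P ζ × (∀ n → ζ #ᴿ s n)

Countable : ∀ {ℓ} → Pred ℝ ℓ → Set (lsuc 0ℓ ⊔ˡ ℓ)
Countable P = Σ[ s ∈ (ℕ → ℝ) ] (∀ ζ → P ζ → ∃[ n ] ζ ≃ᴿ s n)

#⇒¬≃ : ∀ x y → x #ᴿ y → ¬ x ≃ᴿ y
#⇒¬≃ x y (inj₁ (q , Uq , Lq)) (_ , y≤x) = disjoint x (y≤x q Lq) Uq
#⇒¬≃ x y (inj₂ (q , Uq , Lq)) (x≤y , _) = disjoint y (x≤y q Lq) Uq

uncountable⇒¬countable : ∀ {ℓ} {P : Pred ℝ ℓ} → UncountablyMany P → ¬ Countable P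
uncountable⇒¬countable unc (s , enum) =
  let ζ , Pζ , apart = unc s
      n , ζ≃sn = enum ζ Pζ
  in #⇒¬≃ ζ (s n) (apart n) ζ≃sn

-- z is interior to I if some open interval around z is contained in I.
Interior : ∀ {ℓ} → Pred ℝ ℓ → Pred ℝ (lsuc 0ℓ ⊔ˡ ℓ)
Interior I z = ∃₂ λ u v → u <ᴿ z × z <ᴿ v × (∀ w → u <ᴿ w → w <ᴿ v → I w)

{-# OPTIONS --safe #-}

-- A Baire category argument in (0,∞).  The rationals t = r^m are dense, and t^(n/m) = r^n is
-- rational; so near any point there is an interval on which u^(n/m) is as close as desired to
-- a rational, relative to the denominator of that rational.  Being so approximable, for given
-- n/m and given order of approximation, is thus a dense condition with interior, and so is
-- being apart from a given real or having u^(n/m) apart from a given rational.  There are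
-- countably many such conditions, and a point satisfying all of them is a Liouville number
-- all of whose powers with non-zero rational exponent are Liouville.

module Submission where

open import Defs
open import Level using (Level)
open import Data.Nat.Base as ℕ using (ℕ; zero; suc)
import Data.Nat.Coprimality as Coprimality
import Data.Nat.Properties as ℕₚ
open import Data.Integer.Base as ℤ using (ℤ; +_; -[1+_])
import Data.Integer.Properties as ℤₚ
import Data.Integer.GCD as ℤ
open import Data.Rational.Base
open import Data.Rational.Properties
import Data.Rational.Unnormalised.Base as ℚᵘ
open import Data.Rational.Solver using (module +-*-Solver)
open import Data.List.Base using ([]; _∷_)
open import Data.List.Relation.Unary.All using (All; []; _∷_; lookup)
import Data.List.Relation.Unary.All as All
open import Data.Product.Base using (Σ; ∃; ∃₂; ∃-syntax; _×_; _,_; proj₁; proj₂)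
open import Data.Product.Function.NonDependent.Propositional using (_×-↠_)
open import Data.Sum.Base using (_⊎_; inj₁; inj₂; [_,_]′)
open import Data.Empty using (⊥; ⊥-elim)
open import Function.Bundles using (_↠_; mk↠ₛ; module Surjection)
open import Function.Construct.Composition using (_↠-∘_)
open import Function.Construct.Identity using (↠-id)
open import Relation.Nullary using (Dec; yes; no)
open import Relation.Unary using (Pred)
open import Relation.Binary.PropositionalEquality
  using (_≡_; refl; sym; trans; cong; subst; subst₂)

open +-*-Solver using (solve; _:=_; _:+_; _:*_; :-_)

-- Inequalities between rationals, and cuts under weak inequalities.

p-q<p : ∀ {p q} → 0ℚ < q → p - q < p
p-q<p {p} {q} 0<q = subst (p - q <_) (+-identityʳ p) (+-monoʳ-< p (neg-antimono-< 0<q))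

p<p+q : ∀ {p q} → 0ℚ < q → p < p + q
p<p+q {p} {q} 0<q = subst (_< p + q) (+-identityʳ p) (+-monoʳ-< p 0<q)

p<q⇒0<q-p : ∀ {p q} → p < q → 0ℚ < q - p
p<q⇒0<q-p {p} {q} p<q = subst (_< q - p) (+-inverseʳ p) (+-monoˡ-< (- p) p<q)

p-q+q≡p : ∀ p q → p - q + q ≡ p
p-q+q≡p = solve 2 (λ p q → p :+ :- q :+ q := p) refl

p+q-q≡p : ∀ p q → p + q - q ≡ p
p+q-q≡p = solve 2 (λ p q → p :+ q :+ :- q := p) refl

-p<q⇒-q<p : ∀ {p q} → - p < q → - q < p
-p<q⇒-q<p {p} {q} -p<q = subst (- q <_) (solve 1 (λ p → :- (:- p) := p) refl p) (neg-antimono-< -p<q)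

ι≤ι-suc : ∀ n → ι n ≤ ι (suc n)
ι≤ι-suc n = subst₂ _≤_ (+-identityˡ (ι n)) (sym (ι-suc n)) (+-monoˡ-≤ (ι n) (<⇒≤ 0<1))

L-≤ : ∀ x {p q} → p ≤ q → L x q → L x p
L-≤ x p≤q Lq = let r , q<r , Lr = L-open x Lq in L-down x (≤-<-trans p≤q q<r) Lr

U-≤ : ∀ x {p q} → p ≤ q → U x p → U x q
U-≤ x p≤q Up = let r , r<p , Ur = U-open x Up in U-up x (<-≤-trans r<p p≤q) Ur

-- Enumerations

-- Follows the antidiagonals of ℕ × ℕ.
unpair : ℕ → ℕ × ℕ
unpair zero = 0 , 0
unpair (suc n) with unpair n
... | zero  , j = suc j , 0
... | suc i , j = i , suc j

-- Traces each pair back to its predecessor: for j > 0 the one before it on the same antidiagonal,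
-- for j = 0 the last one of the previous antidiagonal.
unpair-surjective : ∀ ij → ∃[ n ] unpair n ≡ ij
unpair-surjective (i , j) = antidiagonal (i ℕ.+ j) i j refl
  where
  antidiagonal : ∀ k i j → i ℕ.+ j ≡ k → ∃[ n ] unpair n ≡ (i , j)
  antidiagonal zero zero zero refl = 0 , refl
  antidiagonal (suc k) (suc i) zero eq
    with antidiagonal k 0 i (ℕₚ.suc-injective (trans (cong suc (sym (ℕₚ.+-identityʳ i))) eq))
  ... | n , eqₙ = suc n , step eqₙ
    where
    step : unpair n ≡ (0 , i) → unpair (suc n) ≡ (suc i , 0)
    step e with unpair n
    step refl | _ = refl
  antidiagonal k i (suc j) eq with antidiagonal k (suc i) j (trans (sym (ℕₚ.+-suc i j)) eq)
  ... | n , eqₙ = suc n , step eqₙ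
    where
    step : unpair n ≡ (suc i , j) → unpair (suc n) ≡ (i , suc j)
    step e with unpair n
    step refl | _ = refl

ℕ↠ℕ×ℕ : ℕ ↠ (ℕ × ℕ)
ℕ↠ℕ×ℕ = mk↠ₛ unpair-surjective

ℕ↠× : ∀ {A B : Set} → ℕ ↠ A → ℕ ↠ B → ℕ ↠ (A × B)
ℕ↠× f g = (f ×-↠ g) ↠-∘ ℕ↠ℕ×ℕ

ℕ↠ℤ : ℕ ↠ ℤ
ℕ↠ℤ = mk↠ₛ {to = λ (i , j) → i ℤ.⊖ j} preimage ↠-∘ ℕ↠ℕ×ℕ
  where
  preimage : ∀ z → ∃[ ij ] proj₁ ij ℤ.⊖ proj₂ ij ≡ z
  preimage (+ n)    = (n , 0) , refl
  preimage -[1+ n ] = (0 , suc n) , refl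

ℕ↠ℚ : ℕ ↠ ℚ
ℕ↠ℚ = mk↠ₛ {to = λ (i , d) → i / suc d} (λ { p@record{} → (↥ p , ℚ.denominator-1 p) , ↥p/↧p≡p p })
  ↠-∘ ℕ↠× ℕ↠ℤ (↠-id ℕ)

-- Intervals and dense conditions

record Interval : Set where
  constructor interval
  field
    {lo hi} : ℚ
    0<lo    : 0ℚ < lo
    lo<hi   : lo < hi

open Interval

infix 4 _⊆_ _∈_

_⊆_ : Interval → Interval → Set
I ⊆ J = lo J ≤ lo I × hi I ≤ hi J

_∈_ : ℝ → Interval → Set
ζ ∈ I = L ζ (lo I) × U ζ (hi I)

⊆-trans : ∀ {I J K} → I ⊆ J → J ⊆ K → I ⊆ K
⊆-trans (l₁ , h₁) (l₂ , h₂) = ≤-trans l₂ l₁ , ≤-trans h₁ h₂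

⊆-∈ : ∀ {I J} ζ → I ⊆ J → ζ ∈ I → ζ ∈ J
⊆-∈ ζ (l , h) (Ll , Uh) = L-≤ ζ l Ll , U-≤ ζ h Uh

-- Stronger than topological density: the interior of the condition is dense in (0,∞). This is what
-- survives countable intersection.
Dense : (ℝ → Set) → Set₁
Dense P = ∀ J → ∃[ I ] I ⊆ J × (∀ ζ → ζ ∈ I → P ζ)

dense-× : ∀ {P Q} → Dense P → Dense Q → Dense (λ ζ → P ζ × Q ζ)
dense-× dP dQ J =
  let I , I⊆J , PI = dP J
      K , K⊆I , QK = dQ I
  in K , ⊆-trans {K} {I} {J} K⊆I I⊆J , λ ζ ζ∈K → PI ζ (⊆-∈ {K} {I} ζ K⊆I ζ∈K) , QK ζ ζ∈K

-- Nested intervals and their common point.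

module Baire {P : ℕ → ℝ → Set} (dense : ∀ n → Dense (P n)) (J : Interval) where

  1/suc : ∀ n → ∃[ e ] 0ℚ < e × e * ι (suc n) ≡ 1ℚ
  1/suc n = quotient (<-≤-trans 0<1 (1≤ι (suc n))) 0<1

  shrinkTo : ∀ I {e} → 0ℚ < e → ∃[ K ] lo I < lo K × hi K < hi I × hi K < lo K + e
  shrinkTo I {e} 0<e with <-dense (lo<hi I)
  ... | a , lo<a , a<hi with ≤-total (hi I) (a + e)
  ...   | inj₁ hi≤ = let b , a<b , b<hi = <-dense a<hi in
    interval (<-trans (0<lo I) lo<a) a<b , lo<a , b<hi , <-≤-trans b<hi hi≤
  ...   | inj₂ ≤hi = let b , a<b , b< = <-dense (p<p+q 0<e) in
    interval (<-trans (0<lo I) lo<a) a<b , lo<a , <-≤-trans b< ≤hi , b<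

  step : ∀ n I → ∃[ K ] lo I < lo K × hi K < hi I × hi K < lo K + proj₁ (1/suc n) ×
                        (∀ ζ → ζ ∈ K → P n ζ)
  step n I =
    -- Shrinking comes first, since `Dense` gives only weak inclusion; strict inclusion at every
    -- step is what puts `limit` inside each interval.
    let K , lo< , hi< , short = shrinkTo I (proj₁ (proj₂ (1/suc n)))
        M , (lo≤ , hi≤) , PM = dense n K
    in M , <-≤-trans lo< lo≤ , ≤-<-trans hi≤ hi< ,
       ≤-<-trans hi≤ (<-≤-trans short (+-monoˡ-≤ (proj₁ (1/suc n)) lo≤)) , PM

  chain : ℕ → Interval
  chain zero    = J
  chain (suc n) = proj₁ (step n (chain n))

  lo-step : ∀ n → lo (chain n) < lo (chain (suc n))
  lo-step n = proj₁ (proj₂ (step n (chain n)))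

  hi-step : ∀ n → hi (chain (suc n)) < hi (chain n)
  hi-step n = proj₁ (proj₂ (proj₂ (step n (chain n))))

  length-step : ∀ n → hi (chain (suc n)) < lo (chain (suc n)) + proj₁ (1/suc n)
  length-step n = proj₁ (proj₂ (proj₂ (proj₂ (step n (chain n)))))

  chain-⊆ : ∀ {m n} → m ℕ.≤′ n → chain n ⊆ chain m
  chain-⊆ ℕ.≤′-refl         = ≤-refl , ≤-refl
  chain-⊆ (ℕ.≤′-step {n} m≤n) = let l , h = chain-⊆ m≤n in
    ≤-trans l (<⇒≤ (lo-step n)) , ≤-trans (<⇒≤ (hi-step n)) h

  lo<hi-chain : ∀ m n → lo (chain m) < hi (chain n)
  lo<hi-chain m n with ℕₚ.≤-total m n
  ... | inj₁ m≤n = ≤-<-trans (proj₁ (chain-⊆ (ℕₚ.≤⇒≤′ m≤n))) (lo<hi (chain n))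
  ... | inj₂ n≤m = <-≤-trans (lo<hi (chain m)) (proj₂ (chain-⊆ (ℕₚ.≤⇒≤′ n≤m)))

  short : ∀ {ε} → 0ℚ < ε → ∃[ n ] hi (chain n) < lo (chain n) + ε
  short {ε} 0<ε = let n , 1<nε = archimedean 1ℚ 0<ε in
    suc n , <-trans (length-step n) (+-monoʳ-< (lo (chain (suc n))) (e<ε n 1<nε))
    where
    e<ε : ∀ n → 1ℚ < ι n * ε → proj₁ (1/suc n) < ε
    e<ε n 1<nε = *-cancel-<ʳ (<-≤-trans 0<1 (1≤ι (suc n)))
      (subst₂ _<_ (sym (proj₂ (proj₂ (1/suc n)))) (*-comm (ι (suc n)) ε)
        (<-≤-trans 1<nε (*-mono-≤ʳ (<⇒≤ 0<ε) (ι≤ι-suc n))))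

  -- Located because an interval of the chain that is shorter than q - p and starts at or below p
  -- must end before q.
  limit : ℝ
  limit = record
    { L = λ q → ∃[ n ] q < lo (chain n)
    ; U = λ q → ∃[ n ] hi (chain n) < q
    ; L-inhab = lo J , 1 , lo-step 0
    ; U-inhab = hi J , 1 , hi-step 0
    ; L-down = λ p<q (n , q<) → n , <-trans p<q q<
    ; U-up = λ p<q (n , <p) → n , <-trans <p p<q
    ; L-open = λ (n , q<) → lo (chain n) , q< , suc n , lo-step n
    ; U-open = λ (n , <q) → hi (chain n) , <q , suc n , hi-step n
    ; disjoint = λ (m , q<) (n , <q) → <-irrefl refl (<-trans (lo<hi-chain m n) (<-trans <q q<))
    ; located = loc
    }
    where
    loc : ∀ {p q} → p < q → (∃[ n ] p < lo (chain n)) ⊎ (∃[ n ] hi (chain n) < q)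
    loc {p} {q} p<q = let n , hi< = short (p<q⇒0<q-p p<q) in
      split-at n hi< (≤or> (lo (chain n)) p)
      where
      split-at : ∀ n → hi (chain n) < lo (chain n) + (q - p) → lo (chain n) ≤ p ⊎ p < lo (chain n) →
                 (∃[ n ] p < lo (chain n)) ⊎ (∃[ n ] hi (chain n) < q)
      split-at n _   (inj₂ p<lo) = inj₁ (n , p<lo)
      split-at n hi< (inj₁ lo≤p) = inj₂ (n , <-≤-trans hi< (≤-trans (+-monoˡ-≤ (q - p) lo≤p)
        (≤-reflexive (trans (+-comm p (q - p)) (p-q+q≡p q p)))))

  limit∈ : ∀ n → limit ∈ chain n
  limit∈ n = (suc n , lo-step n) , (suc n , hi-step n)

  limit-satisfies : ∀ n → P n limit
  limit-satisfies n = proj₂ (proj₂ (proj₂ (proj₂ (step n (chain n))))) limit (limit∈ (suc n))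

-- A surjection from ℕ is enough, as imposing a condition repeatedly does no harm.
baire : ∀ {T : Set} → ℕ ↠ T → {P : T → ℝ → Set} → (∀ t → Dense (P t)) →
        ∀ J → ∃[ ζ ] ζ ∈ J × (∀ t → P t ζ)
baire e {P} dense J = limit , limit∈ 0 , λ t →
  let n , hit = strictlySurjective t in subst (λ t → P t limit) hit (limit-satisfies n)
  where
  open Surjection e
  open Baire (λ n → dense (to n)) J

-- Avoiding a real, and a rational value of u ↦ u^ρ

-- For a < b inside J, locatedness puts x above a or below b; keep the part of J on the other side.
apart-dense : ∀ x → Dense (_#ᴿ x)
apart-dense x J with <-dense (lo<hi J)
... | a , lo<a , a<hi with <-dense a<hi
...   | b , a<b , b<hi with located x a<b
...     | inj₁ La = interval (0<lo J) lo<a , (≤-refl , <⇒≤ a<hi) , λ ζ (_ , Ua) → inj₁ (a , Ua , La)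
...     | inj₂ Ub = interval (<-trans (0<lo J) lo<b) b<hi , (<⇒≤ lo<b , ≤-refl) ,
            λ ζ (Lb , _) → inj₂ (b , Ub , Lb)
  where lo<b = <-trans lo<a a<b

rpow-below : ∀ ρ {q} I → q <pow[ lo I , ρ ] → q <pow[ hi I , ρ ] →
             ∀ ζ → ζ ∈ I → ∀ 0<ζ → L (rpow ρ (ζ , 0<ζ)) q
rpow-below ρ I lo< hi< ζ (Ll , Uh) _ = lo I , hi I , 0<lo I , Ll , Uh , lo< , hi<

rpow-above : ∀ ρ {q} I → q >pow[ lo I , ρ ] → q >pow[ hi I , ρ ] →
             ∀ ζ → ζ ∈ I → ∀ 0<ζ → U (rpow ρ (ζ , 0<ζ)) q
rpow-above ρ I lo> hi> ζ (Ll , Uh) _ = lo I , hi I , 0<lo I , Ll , Uh , lo> , hi>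

SameSide : ℚ → ℚ → Interval → Set
SameSide ρ q I = q <pow[ lo I , ρ ] × q <pow[ hi I , ρ ] ⊎ q >pow[ lo I , ρ ] × q >pow[ hi I , ρ ]

-- Strict monotonicity of u^ρ reduces the choice to one comparison of rationals, at a or at b by the
-- sign of ρ. The gap between a and b absorbs the case of equality.
sameSide : ∀ ρ q → ℤ.NonZero (↥ ρ) → ∀ J → ∃[ I ] I ⊆ J × SameSide ρ q I
sameSide ρ q nz J with ≤or> q 0ℚ
... | inj₁ q≤0 = J , (≤-refl , ≤-refl) , inj₁ (inj₁ q≤0 , inj₁ q≤0)
... | inj₂ 0<q with <-dense (lo<hi J)
...   | a , lo<a , a<hi with <-dense a<hi
...     | b , a<b , b<hi = go ρ nz
  where
  0<a : 0ℚ < a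
  0<a = <-trans (0<lo J) lo<a
  0<b : 0ℚ < b
  0<b = <-trans 0<a a<b
  left : Interval
  left = interval (0<lo J) lo<a
  left⊆ : left ⊆ J
  left⊆ = ≤-refl , <⇒≤ a<hi
  right : Interval
  right = interval 0<b b<hi
  right⊆ : right ⊆ J
  right⊆ = <⇒≤ (<-trans lo<a a<b) , ≤-refl
  go : ∀ ρ → ℤ.NonZero (↥ ρ) → ∃[ I ] I ⊆ J × SameSide ρ q I
  go (mkℚ (+ suc k) d _) _ with ≤or> (q ^ suc d * 1ℚ) (a ^ suc k)
  ... | inj₁ ≤a = right , right⊆ , inj₁ (inj₂ <b , inj₂ (<-trans <b (^-mono-< k 0<b b<hi)))
    where <b = ≤-<-trans ≤a (^-mono-< k 0<a a<b)
  ... | inj₂ a< = left , left⊆ , inj₂ ((0<q , <-trans (^-mono-< k (0<lo J) lo<a) a<) , (0<q , a<))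
  go (mkℚ -[1+ k ] d _) _ with ≤or> (q ^ suc d * b ^ suc k) 1ℚ
  ... | inj₁ b≤ = left , left⊆ , inj₁ (inj₂ (<-trans (mono (0<lo J) lo<a) a<) , inj₂ a<)
    where
    mono : ∀ {u v} → 0ℚ < u → u < v → q ^ suc d * u ^ suc k < q ^ suc d * v ^ suc k
    mono 0<u u<v = *-mono-<ˡ (^-pos (suc d) 0<q) (^-mono-< k 0<u u<v)
    a< = <-≤-trans (mono 0<a a<b) b≤
  ... | inj₂ <b = right , right⊆ , inj₂ ((0<q , <b) , (0<q , <-trans <b
            (*-mono-<ˡ (^-pos (suc d) 0<q) (^-mono-< k 0<b b<hi))))

-- The numerator hypothesis sits inside the condition, so that all rationals can serve as indices;
-- at ρ = 0 the condition is vacuous.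
rpow-apart-dense : ∀ ρ q → Dense (λ ζ → ℤ.NonZero (↥ ρ) → ∀ 0<ζ → rpow ρ (ζ , 0<ζ) #ᴿ fromℚ q)
rpow-apart-dense ρ q J = avoid (ℤₚ._≟_ (↥ ρ) ℤ.0ℤ)
  where
  Goal = ∃[ I ] I ⊆ J × (∀ ζ → ζ ∈ I → ℤ.NonZero (↥ ρ) → ∀ 0<ζ → rpow ρ (ζ , 0<ζ) #ᴿ fromℚ q)
  apart : ∃[ I ] I ⊆ J × SameSide ρ q I → Goal
  apart (I , I⊆J , inj₁ (lo< , hi<)) = I , I⊆J , λ ζ ζ∈I _ 0<ζ →
    let r , q<r , Lr = L-open (rpow ρ (ζ , 0<ζ)) (rpow-below ρ I lo< hi< ζ ζ∈I 0<ζ) in inj₂ (r , q<r , Lr)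
  apart (I , I⊆J , inj₂ (lo> , hi>)) = I , I⊆J , λ ζ ζ∈I _ 0<ζ →
    let r , r<q , Ur = U-open (rpow ρ (ζ , 0<ζ)) (rpow-above ρ I lo> hi> ζ ζ∈I 0<ζ) in inj₁ (r , Ur , r<q)
  avoid : Dec (↥ ρ ≡ ℤ.0ℤ) → Goal
  avoid (no n≢0)  = apart (sameSide ρ q (ℤ.≢-nonZero n≢0) J)
  avoid (yes n≡0) = J , (≤-refl , ≤-refl) , λ _ _ nz → ⊥-elim (ℕ.≢-nonZero⁻¹ ℤ.∣ ↥ ρ ∣ {{nz}} (cong ℤ.∣_∣ n≡0))

-- Rational approximation

-- Doubled so as to be at least 2 even when p is an integer.
den : ℚ → ℚ
den p = ι (↧ₙ p ℕ.* 2)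

2≤den : ∀ p → 1ℚ + 1ℚ ≤ den p
2≤den (mkℚ _ d _) = subst (1ℚ + 1ℚ ≤_) (sym (ι-suc (suc (d ℕ.* 2)))) (+-monoʳ-≤ 1ℚ (1≤ι (suc (d ℕ.* 2))))

1≤den : ∀ p → 1ℚ ≤ den p
1≤den p = ≤-trans (<⇒≤ (p<p+q 0<1)) (2≤den p)

-- A rational form of |ζ - p| < `den p`^(-N), with the error bound as a witness.
WellApproximated : ℝ → ℕ → Set
WellApproximated ζ N = ∃₂ λ p ε → 0ℚ < ε × ε * den p ^ N ≤ 1ℚ × L ζ (p - ε) × U ζ (p + ε)

-- Walk along r, rg, rg², ... from below. Each step multiplies the power by g^(m+1), and c * g^(m+1)
-- < d, so the first power above c cannot jump past d.
powerBetween : ∀ m {c d} → 0ℚ < c → c < d → ∃[ r ] 0ℚ < r × c < r ^ suc m × r ^ suc m < d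
powerBetween m {c} {d} 0<c c<d =
  let g , 1<g , cg<d    = slack (suc m) 0<c c<d
      r , _ , 0<r , r<c = widen {0ℚ} m 0<c 0<1 (inj₁ ≤-refl)
      q , 0<q , c<q     = large m 0<c 0<1
      -- With h = q/r < g^k, the walk has passed q, and hence c, after k steps.
      h , _ , hr≡q      = quotient 0<r 0<q
      k , h<g^k         = exceeds h 1<g
  in walk g (<-trans 0<1 1<g) cg<d k r 0<r
       (<⇒≤ (subst (_< c) (*-identityʳ (r ^ suc m)) r<c))
       (<-trans (subst (c <_) (*-identityʳ (q ^ suc m)) c<q)
         (^-mono-< m 0<q (subst₂ _<_ hr≡q (*-comm (g ^ k) r) (*-mono-<ʳ 0<r h<g^k))))
  where
  walk : ∀ g → 0ℚ < g → c * g ^ suc m < d → ∀ k r → 0ℚ < r → r ^ suc m ≤ c → c < (r * g ^ k) ^ suc m →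
         ∃[ r ] 0ℚ < r × c < r ^ suc m × r ^ suc m < d
  walk g 0<g cg<d zero r 0<r r≤c c<r = ⊥-elim (<-irrefl refl (<-≤-trans c<r
    (subst (λ r → r ^ suc m ≤ c) (sym (*-identityʳ r)) r≤c)))
  walk g 0<g cg<d (suc k) r 0<r r≤c c<r = go (≤or> ((r * g) ^ suc m) c)
    where
    go : (r * g) ^ suc m ≤ c ⊎ c < (r * g) ^ suc m → _
    go (inj₁ rg≤c) = walk g 0<g cg<d k (r * g) (*-pos 0<r 0<g) rg≤c
      (subst (λ s → c < s ^ suc m) (sym (*-assoc r g (g ^ k))) c<r)
    go (inj₂ c<rg) = r * g , *-pos 0<r 0<g , c<rg , ≤-<-trans
      (≤-trans (≤-reflexive (^-distrib-* r g (suc m))) (*-mono-≤ʳ (<⇒≤ (^-pos (suc m) 0<g)) r≤c)) cg<d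

-- Here p = t^ρ exactly, with denominators cleared, and g is so near 1 that changing t by a factor
-- at most g moves its power by less than ε.
module _ {ρ p t g ε} (0<p : 0ℚ < p) (0<t : 0ℚ < t) (1<g : 1ℚ < g) (0<ε : 0ℚ < ε)
  (p≡t^ρ : p ^ ↧ₙ ρ * t ^ negPart (↥ ρ) ≡ t ^ posPart (↥ ρ))
  (pg< : p * g ^ ℤ.∣ ↥ ρ ∣ < p + ε)
  {e} (0<e : 0ℚ < e) (t≤ge : t ≤ g * e) (e≤gt : e ≤ g * t) where

  near-above : p + ε >pow[ e , ρ ]
  near-above = rpow-compare ρ 0<p (p<p+q 0<ε) pg< (<-trans 0<1 1<g) 0<t 0<e t≤ge e≤gt
    (≤-reflexive (sym p≡t^ρ))

  near-below : p - ε <pow[ e , ρ ]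
  near-below = go (≤or> (p - ε) 0ℚ)
    where
    G = g ^ ℤ.∣ ↥ ρ ∣
    -- The bound chosen for the upper side also serves the lower one, because ε * G is at least ε.
    p-ε<p : (p - ε) * G < p
    p-ε<p = begin-strict
      (p - ε) * G     ≡⟨ solve 3 (λ p ε G → (p :+ :- ε) :* G := p :* G :+ :- (ε :* G)) refl p ε G ⟩
      p * G - ε * G   <⟨ +-monoˡ-< (- (ε * G)) pg< ⟩
      p + ε - ε * G   ≤⟨ +-monoʳ-≤ (p + ε) (neg-antimono-≤ (subst (_≤ ε * G) (*-identityʳ ε)
                           (*-mono-≤ˡ (<⇒≤ 0<ε) (1≤^ ℤ.∣ ↥ ρ ∣ (<⇒≤ 1<g))))) ⟩
      p + ε - ε       ≡⟨ p+q-q≡p p ε ⟩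
      p               ∎
      where open ≤-Reasoning
    decide : 0ℚ < p - ε → _ ⊎ _ → p - ε <pow[ e , ρ ]
    decide _     (inj₁ e>) = e>
    -- If e^ρ were at most p - ε, the comparison taken from e to t would give t^ρ < p.
    decide 0<p-ε (inj₂ e≤) = ⊥-elim (<-irrefl (sym p≡t^ρ) (proj₂
      (rpow-compare ρ 0<p-ε (p-q<p 0<ε) p-ε<p (<-trans 0<1 1<g) 0<e 0<t e≤gt t≤ge e≤)))
    go : p - ε ≤ 0ℚ ⊎ 0ℚ < p - ε → p - ε <pow[ e , ρ ]
    go (inj₁ ≤0) = inj₁ ≤0
    go (inj₂ 0<p-ε) = decide 0<p-ε (below? e ρ 0<p-ε)

-- The m-th powers of rationals are dense, and t = r^m has the rational power
-- t^(n/m) = r^n, which can be approached with a precision chosen after its denominator.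
wellApproximated-dense : ∀ ρ N → Dense (λ ζ → ∀ 0<ζ → WellApproximated (rpow ρ (ζ , 0<ζ)) N)
wellApproximated-dense ρ N J = build (powerBetween (ℚ.denominator-1 ρ) (0<lo J) (lo<hi J))
  where
  build : (∃[ r ] 0ℚ < r × lo J < r ^ ↧ₙ ρ × r ^ ↧ₙ ρ < hi J) →
          ∃[ I ] I ⊆ J × (∀ ζ → ζ ∈ I → ∀ 0<ζ → WellApproximated (rpow ρ (ζ , 0<ζ)) N)
  build (r , 0<r , lo<t , t<hi) =
    let p , 0<p , pr≡ = quotient (^-pos (negPart (↥ ρ)) 0<r) (^-pos (posPart (↥ ρ)) 0<r)
        -- The error is exactly `den p`^(-N), so it is fixed only after p = r^n is known.
        ε , 0<ε , εd≡1 = quotient (^-pos N (<-≤-trans 0<1 (1≤den p))) 0<1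
        g , 1<g , pg<  = slack ℤ.∣ ↥ ρ ∣ 0<p (p<p+q 0<ε)
        -- Here a = max(lo J, t/g) and b = min(hi J, g * t), so both ends stay in J and within a
        -- factor g of t.
        a , lo≤a , 0<a , a<t , t≤ga = leftOf 1<g
        b , b≤hi , t<b , b≤gt = rightOf 1<g
        0<b  = <-trans 0<t t<b
        a≤gt = <⇒≤ (<-trans a<t (<-≤-trans t<b b≤gt))
        t≤gb = ≤-trans (<⇒≤ t<b) (subst (_≤ g * b) (*-identityˡ b) (*-mono-≤ʳ (<⇒≤ 0<b) (<⇒≤ 1<g)))
        I = interval 0<a (<-trans a<t t<b)
        p≡ = p≡t^ρ p pr≡
    in I , (lo≤a , b≤hi) , λ ζ ζ∈I 0<ζ → p , ε , 0<ε , ≤-reflexive εd≡1 ,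
       rpow-below ρ I (near-below {ρ} 0<p 0<t 1<g 0<ε p≡ pg< 0<a t≤ga a≤gt)
                      (near-below {ρ} 0<p 0<t 1<g 0<ε p≡ pg< 0<b t≤gb b≤gt) ζ ζ∈I 0<ζ ,
       rpow-above ρ I (near-above {ρ} 0<p 0<t 1<g 0<ε p≡ pg< 0<a t≤ga a≤gt)
                      (near-above {ρ} 0<p 0<t 1<g 0<ε p≡ pg< 0<b t≤gb b≤gt) ζ ζ∈I 0<ζ
    where
    t : ℚ
    t = r ^ ↧ₙ ρ
    0<t : 0ℚ < t
    0<t = ^-pos (↧ₙ ρ) 0<r
    ^-swap : ∀ k → (r ^ k) ^ ↧ₙ ρ ≡ t ^ k
    ^-swap k = trans (^-assocʳ r k (↧ₙ ρ))
      (trans (cong (r ^_) (ℕₚ.*-comm k (↧ₙ ρ))) (sym (^-assocʳ r (↧ₙ ρ) k)))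
    p≡t^ρ : ∀ p → p * r ^ negPart (↥ ρ) ≡ r ^ posPart (↥ ρ) →
            p ^ ↧ₙ ρ * t ^ negPart (↥ ρ) ≡ t ^ posPart (↥ ρ)
    p≡t^ρ p eq = trans (cong (p ^ ↧ₙ ρ *_) (sym (^-swap (negPart (↥ ρ)))))
      (trans (sym (^-distrib-* p (r ^ negPart (↥ ρ)) (↧ₙ ρ)))
        (trans (cong (_^ ↧ₙ ρ) eq) (^-swap (posPart (↥ ρ)))))
    leftOf : ∀ {g} → 1ℚ < g → ∃[ a ] lo J ≤ a × 0ℚ < a × a < t × t ≤ g * a
    leftOf {g} 1<g = let a , 0<a , ag≡t = quotient (<-trans 0<1 1<g) 0<t in
      go a 0<a (trans (*-comm g a) ag≡t) (≤-total (lo J) a)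
      where
      go : ∀ a → 0ℚ < a → g * a ≡ t → lo J ≤ a ⊎ a ≤ lo J →
           ∃[ a ] lo J ≤ a × 0ℚ < a × a < t × t ≤ g * a
      go a 0<a ga≡t (inj₁ lo≤a) = a , lo≤a , 0<a ,
        subst₂ _<_ (*-identityˡ a) ga≡t (*-mono-<ʳ 0<a 1<g) , ≤-reflexive (sym ga≡t)
      go a 0<a ga≡t (inj₂ a≤lo) = lo J , ≤-refl , 0<lo J , lo<t ,
        ≤-trans (≤-reflexive (sym ga≡t)) (*-mono-≤ˡ (<⇒≤ (<-trans 0<1 1<g)) a≤lo)
    rightOf : ∀ {g} → 1ℚ < g → ∃[ b ] b ≤ hi J × t < b × b ≤ g * t
    rightOf {g} 1<g = go (≤-total (g * t) (hi J))
      where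
      go : g * t ≤ hi J ⊎ hi J ≤ g * t → ∃[ b ] b ≤ hi J × t < b × b ≤ g * t
      go (inj₁ gt≤) = g * t , gt≤ , subst (_< g * t) (*-identityˡ t) (*-mono-<ʳ 0<t 1<g) , ≤-refl
      go (inj₂ ≤gt) = hi J , ≤-refl , t<hi , ≤gt

-- From good rational approximations to Liouville numbers.

L-∣-∣-< : ∀ ζ {p ε t} → L ζ (p - ε) → U ζ (p + ε) → L ∣ ζ -ᴿ fromℚ p ∣ᴿ t → t < ε
L-∣-∣-< ζ {p} {ε} {t} _ Up (inj₁ (a , b , La , p<-b , t<)) = begin-strict
  t             <⟨ t< ⟩
  a + b         <⟨ +-monoˡ-< b (L<U ζ La Up) ⟩
  p + ε + b     <⟨ +-monoˡ-< b (+-monoˡ-< ε p<-b) ⟩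
  - b + ε + b   ≡⟨ solve 2 (λ b ε → :- b :+ ε :+ b := ε) refl b ε ⟩
  ε             ∎
  where open ≤-Reasoning
L-∣-∣-< ζ {p} {ε} {t} Lp _ (inj₂ (a , b , Ua , -b<p , <-t)) =
  subst (_< ε) (solve 1 (λ t → :- (:- t) := t) refl t) (-p<q⇒-q<p (begin-strict
  - ε           ≡⟨ solve 2 (λ p ε → :- ε := p :+ :- ε :+ :- p) refl p ε ⟩
  p - ε - p     <⟨ +-mono-< (L<U ζ Lp Ua) (-p<q⇒-q<p -b<p) ⟩
  a + b         <⟨ <-t ⟩
  - t           ∎))
  where open ≤-Reasoning

-- `Approximant` admits fractions not in lowest terms, so p may be presented with its doubled
-- denominator.
↥*2/↧*2≡ : ∀ p → p ≡ (↥ p ℤ.* + 2) / (↧ₙ p ℕ.* 2)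
↥*2/↧*2≡ p@record{} = sym (trans
  (fromℚᵘ-cong {ℚᵘ.mkℚᵘ (↥ p ℤ.* + 2) _} {ℚᵘ.mkℚᵘ (↥ p) (ℚ.denominator-1 p)} (ℚᵘ.*≡*
    (trans (ℤₚ.*-assoc (↥ p) (+ 2) (↧ p))
      (cong (ℤ._*_ (↥ p)) (trans (ℤₚ.*-comm (+ 2) (↧ p)) (sym (ℤₚ.pos-* (↧ₙ p) 2)))))))
  (↥p/↧p≡p p))

-- Built with `mkℚ` so that numerator and denominator, also after negation, are found by
-- computation.
suc/1 : ℕ → ℚ
suc/1 n = mkℚ (+ suc n) 0 (Coprimality.sym (Coprimality.1-coprimeTo (suc n)))

boundedByℕ : ∀ η → ∃[ n ] U η (suc/1 n)
boundedByℕ η = let u , Uu = U-inhab η ; n , u<n = archimedean u 0<1 in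
  n , U-≤ η (<⇒≤ (<-≤-trans (subst (u <_) (*-identityʳ (ι n)) u<n)
    (≤-trans (ι≤ι-suc n) (≤-reflexive (↥p/↧p≡p (suc/1 n)))))) Uu

below-^ᴿ- : ∀ x .{{_ : ℕ.NonZero x}} {η n t} → U η (suc/1 n) → t * ι x ^ suc n < 1ℚ → L (x ^ᴿ (-ᴿ η)) t
below-^ᴿ- x {n = n} {t} Un t< = - suc/1 n , Un ,
  inj₂ (subst (λ s → s * ι x ^ suc n < 1ℚ) (sym (*-identityʳ t)) t<)

FarFrom : ℝ → ℚ → ℚ → Set
FarFrom ζ δ q = ∀ ε → ε ≤ δ → L ζ (q - ε) → U ζ (q + ε) → ⊥

farFrom-min : ∀ {ζ δ δ′ q qs} → 0ℚ < δ → FarFrom ζ δ q → 0ℚ < δ′ → All (FarFrom ζ δ′) qs →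
              ∃[ δ ] 0ℚ < δ × All (FarFrom ζ δ) (q ∷ qs)
farFrom-min {δ = δ} {δ′} 0<δ far 0<δ′ allFar with ≤-total δ δ′
... | inj₁ δ≤δ′ = δ , 0<δ , far ∷ All.map (λ far′ ε ε≤ → far′ ε (≤-trans ε≤ δ≤δ′)) allFar
... | inj₂ δ′≤δ = δ′ , 0<δ′ , (λ ε ε≤ → far ε (≤-trans ε≤ δ′≤δ)) ∷ allFar

#⇒farFrom : ∀ ζ q → ζ #ᴿ fromℚ q → ∃[ δ ] 0ℚ < δ × FarFrom ζ δ q
#⇒farFrom ζ q (inj₁ (t , Ut , t<q)) = q - t , p<q⇒0<q-p t<q ,
  λ ε ε≤ Lq _ → <-irrefl refl (<-≤-trans (L<U ζ Lq Ut)
    (subst (_≤ q - ε) (solve 2 (λ q t → q :+ :- (q :+ :- t) := t) refl q t)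
      (+-monoʳ-≤ q (neg-antimono-≤ ε≤))))
#⇒farFrom ζ q (inj₂ (t , q<t , Lt)) = t - q , p<q⇒0<q-p q<t ,
  λ ε ε≤ _ Uq → <-irrefl refl (<-≤-trans (L<U ζ Lt Uq)
    (subst (q + ε ≤_) (trans (+-comm q (t - q)) (p-q+q≡p t q)) (+-monoʳ-≤ q ε≤)))

-- Finitely many rationals keep a positive distance from ζ, so a sufficiently close approximation is
-- not among them.
separated : ∀ ζ → Irrational ζ → ∀ qs → ∃[ δ ] 0ℚ < δ × All (FarFrom ζ δ) qs
separated ζ irr []       = 1ℚ , 0<1 , []
separated ζ irr (q ∷ qs) =
  let δ , 0<δ , far      = #⇒farFrom ζ q (irr q)
      δ′ , 0<δ′ , allFar = separated ζ irr qs
  in farFrom-min {ζ} 0<δ far 0<δ′ allFar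

liouville : ∀ ζ → Irrational ζ → (∀ N → WellApproximated ζ N) → Liouville ζ
liouville ζ irr approx = irr , λ η _ → infinitelyMany η
  where
  infinitelyMany : ∀ η → InfinitelyMany (Approximant ζ η)
  infinitelyMany η qs =
    let m , Um = boundedByℕ η
        δ , 0<δ , allFar = separated ζ irr qs
        h , _ , hδ≡1 = quotient 0<δ 0<1
        k , h<2^k = exceeds h (p<p+q 0<1)
        -- The order has two purposes: exponent m + 1 exceeds η, and the factor `den p`^k, being at
        -- least 2^k > 1/δ, forces ε ≤ δ.
        p , ε , 0<ε , εd≤1 , Lp , Up = approx (suc m ℕ.+ k)
        x = ↧ₙ p ℕ.* 2
        ε-bound : ∀ {n} → n ℕ.≤ suc m ℕ.+ k → ε * den p ^ n ≤ 1ℚ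
        ε-bound n≤ = ≤-trans (*-mono-≤ˡ (<⇒≤ 0<ε) (^-monoʳ-≤ (1≤den p) n≤)) εd≤1
        0<d^m = ^-pos (suc m) (<-≤-trans 0<1 (1≤den p))
        2^k≤d^k = ^-mono-≤ k (<-trans 0<1 (p<p+q 0<1)) (2≤den p)
        ε≤δ = ≤of 0<δ 0<ε hδ≡1 (<-≤-trans h<2^k 2^k≤d^k) (ε-bound (ℕₚ.m≤n+m k (suc m)))
    in p , (λ p∈qs → lookup allFar p∈qs ε ε≤δ Lp Up) , ↥ p ℤ.* + 2 , x , _ , ↥*2/↧*2≡ p ,
       -- `≤ᴿ` compares lower cuts: any t below the distance is less than ε, hence t * x^(m+1) < 1.
       λ t Lt → below-^ᴿ- x {η} Um (<-≤-trans (*-mono-<ʳ 0<d^m (L-∣-∣-< ζ Lp Up Lt))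
                  (ε-bound (ℕₚ.m≤m+n (suc m) k)))
    where
    ≤of : ∀ {δ ε h D} → 0ℚ < δ → 0ℚ < ε → h * δ ≡ 1ℚ → h < D → ε * D ≤ 1ℚ → ε ≤ δ
    ≤of {δ} {ε} {h} {D} 0<δ 0<ε hδ≡1 h<D εD≤1 = begin
      ε           ≡⟨ sym (*-identityʳ ε) ⟩
      ε * 1ℚ      ≡⟨ cong (ε *_) (sym hδ≡1) ⟩
      ε * (h * δ) ≡⟨ sym (*-assoc ε h δ) ⟩
      ε * h * δ   ≤⟨ *-mono-≤ʳ (<⇒≤ 0<δ) (≤-trans (*-mono-≤ˡ (<⇒≤ 0<ε) (<⇒≤ h<D)) εD≤1) ⟩
      1ℚ * δ      ≡⟨ *-identityˡ δ ⟩
      δ           ∎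
      where open ≤-Reasoning

-- Liouville numbers with Liouville powers

-- All requirements share one index, so the category argument runs once; n is both a position in s
-- and an order of approximation.
Generic : (ℕ → ℝ) → ℚ × ℚ × ℕ → ℝ → Set
Generic s (ρ , q , n) ζ = ζ #ᴿ s n ×
  (ℤ.NonZero (↥ ρ) → ∀ 0<ζ → rpow ρ (ζ , 0<ζ) #ᴿ fromℚ q) ×
  (∀ 0<ζ → WellApproximated (rpow ρ (ζ , 0<ζ)) n)

generic-dense : ∀ s i → Dense (Generic s i)
generic-dense s (ρ , q , n) =
  dense-× {_#ᴿ s n} (apart-dense (s n)) (dense-× (rpow-apart-dense ρ q) (wellApproximated-dense ρ n))

-- Allows ζ itself to be treated as its power with exponent 1, whose cuts are defined differently.
rpow-1-L : ∀ ζ 0<ζ {q} → L (rpow 1ℚ (ζ , 0<ζ)) q → L ζ q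
rpow-1-L ζ 0<ζ (c , d , 0<c , Lc , _ , inj₁ q≤0 , _) = L-≤ ζ (≤-trans q≤0 (<⇒≤ 0<c)) Lc
rpow-1-L ζ 0<ζ {q} (c , d , 0<c , Lc , _ , inj₂ q<c , _) = L-down ζ
  (subst₂ _<_ (trans (*-identityʳ (q ^ 1)) (*-identityʳ q)) (*-identityʳ c) q<c) Lc

rpow-1-U : ∀ ζ 0<ζ {q} → U (rpow 1ℚ (ζ , 0<ζ)) q → U ζ q
rpow-1-U ζ 0<ζ {q} (c , d , _ , _ , Ud , _ , (_ , d<q)) = U-up ζ
  (subst₂ _<_ (*-identityʳ d) (trans (*-identityʳ (q ^ 1)) (*-identityʳ q)) d<q) Ud

-- Powers are taken for every proof of positivity, since `rpow` uses that proof as data and a subset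
-- of (0,∞) brings its own.
LiouvillePowers : Interval → ℝ → Set₁
LiouvillePowers J ζ = ζ ∈ J × Liouville ζ ×
  (∀ ρ → ℤ.NonZero (↥ ρ) → ∀ 0<ζ → Liouville (rpow ρ (ζ , 0<ζ)))

-- The sequence to be avoided enters the generic conditions, so uncountability needs no separate
-- argument.
liouvillePowers : ∀ J → UncountablyMany (LiouvillePowers J)
liouvillePowers J s =
  let ζ , ζ∈J , generic = baire (ℕ↠× ℕ↠ℚ (ℕ↠× ℕ↠ℚ (↠-id ℕ))) (generic-dense s) J
      0<ζ = lo J , 0<lo J , proj₁ ζ∈J
      irrational : ∀ ρ → ℤ.NonZero (↥ ρ) → ∀ 0<ζ → Irrational (rpow ρ (ζ , 0<ζ))
      -- Each condition reads only some components of the index; the others are filled with zeros.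
      irrational ρ nz 0<ζ q = proj₁ (proj₂ (generic (ρ , q , 0))) nz 0<ζ
      approx : ∀ ρ 0<ζ N → WellApproximated (rpow ρ (ζ , 0<ζ)) N
      approx ρ 0<ζ N = proj₂ (proj₂ (generic (ρ , 0ℚ , N))) 0<ζ
  in ζ , (ζ∈J ,
    liouville ζ (λ q → irrational-1 ζ 0<ζ q (irrational 1ℚ _ 0<ζ q)) (λ N → approx-1 ζ 0<ζ N (approx 1ℚ 0<ζ N)) ,
    λ ρ nz 0<ζ → liouville (rpow ρ (ζ , 0<ζ)) (irrational ρ nz 0<ζ) (approx ρ 0<ζ)) ,
    λ n → proj₁ (generic (0ℚ , 0ℚ , n))
  where
  irrational-1 : ∀ ζ 0<ζ q → rpow 1ℚ (ζ , 0<ζ) #ᴿ fromℚ q → ζ #ᴿ fromℚ q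
  irrational-1 ζ 0<ζ q (inj₁ (r , Ur , r<q)) = inj₁ (r , rpow-1-U ζ 0<ζ Ur , r<q)
  irrational-1 ζ 0<ζ q (inj₂ (r , q<r , Lr)) = inj₂ (r , q<r , rpow-1-L ζ 0<ζ Lr)
  approx-1 : ∀ ζ 0<ζ N → WellApproximated (rpow 1ℚ (ζ , 0<ζ)) N → WellApproximated ζ N
  approx-1 ζ 0<ζ N (p , ε , 0<ε , εd≤1 , Lp , Up) =
    p , ε , 0<ε , εd≤1 , rpow-1-L ζ 0<ζ Lp , rpow-1-U ζ 0<ζ Up

-- Reduction only divides the signed a by a gcd, so a zero numerator would make the sign or a
-- vanish.
÷ᶻ-nonZero : ∀ a b .{{_ : ℤ.NonZero a}} .{{_ : ℤ.NonZero b}} → ℤ.NonZero (↥ (a ÷ᶻ b))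
÷ᶻ-nonZero a b = ℤ.≢-nonZero λ ↥≡0 →
  [ (λ σ≡0 → ℕₚ.1+n≢0 (trans (sym (ℤₚ.abs-◃ (ℤ.sign b) 1)) (cong ℤ.∣_∣ σ≡0)))
  , (λ a≡0 → ℕ.≢-nonZero⁻¹ ℤ.∣ a ∣ (cong ℤ.∣_∣ a≡0)) ]′
  (ℤₚ.i*j≡0⇒i≡0∨j≡0 σ (trans (sym (↥-/ (σ ℤ.* a) ℤ.∣ b ∣))
    (cong (ℤ._* ℤ.gcd (σ ℤ.* a) (+ ℤ.∣ b ∣)) {↥ (a ÷ᶻ b)} ↥≡0)))
  where
  σ : ℤ
  σ = ℤ.sign b ℤ.◃ 1

-- Rationals a and b separate z from u and v. As z lies in I, some positive c is below z, and max(a,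
-- c) is a positive lower end.
interior⇒interval : ∀ {ℓ} {I : Pred ℝ ℓ} → (∀ {z} → I z → 0ᴿ <ᴿ z) → ∃ (Interior I) →
                    ∃[ J ] (∀ ζ → ζ ∈ J → I ζ)
interior⇒interval {I = I} I⊆ (z , u , v , u<z@(a , Ua , La) , z<v@(b , Ub , Lb) , inside) =
  above0 (I⊆ (inside z u<z z<v))
  where
  above0 : 0ᴿ <ᴿ z → ∃[ J ] (∀ ζ → ζ ∈ J → I ζ)
  above0 (c , 0<c , Lc) with ≤-total a c
  ... | inj₁ a≤c = interval 0<c (L<U z Lc Ub) , λ ζ (Ll , Uh) →
    inside ζ (c , U-≤ u a≤c Ua , Ll) (b , Uh , Lb)
  ... | inj₂ c≤a = interval (<-≤-trans 0<c c≤a) (L<U z La Ub) , λ ζ (Ll , Uh) →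
    inside ζ (a , Ua , Ll) (b , Uh , Lb)

-- All powers at once, and one power within a given set.

module _ (J : Interval) (s : ℕ → ℝ) where

  Generated : Set₁
  Generated = ∃[ ζ ] LiouvillePowers J ζ × (∀ n → ζ #ᴿ s n)

  everyPower : Generated → ∃[ ζ ] (Liouville ζ × Σ (0ᴿ <ᴿ ζ) (λ 0<ζ →
    (a b : ℤ) .{{_ : ℤ.NonZero a}} .{{_ : ℤ.NonZero b}} →
    Liouville (proj₁ (f a b (ζ , 0<ζ))))) × (∀ n → ζ #ᴿ s n)
  everyPower (ζ , ((Lζ , _) , ζ-liouville , powers) , apart) =
    ζ , (ζ-liouville , 0<ζ , λ a b → powers (a ÷ᶻ b) (÷ᶻ-nonZero a b) 0<ζ) , apart
    where
    0<ζ : 0ᴿ <ᴿ ζ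
    0<ζ = lo J , 0<lo J , Lζ

  onePower : ∀ {ℓ} (I : Pred ℝ ℓ) (I⊆ : ∀ {z} → I z → 0ᴿ <ᴿ z) → (∀ ζ → ζ ∈ J → I ζ) →
    (a b : ℤ) .{{_ : ℤ.NonZero a}} .{{_ : ℤ.NonZero b}} → Generated →
    ∃[ ζ ] (Liouville ζ × Σ (I ζ) (λ ζ∈I → Liouville (proj₁ (f a b (ζ , I⊆ ζ∈I))))) × (∀ n → ζ #ᴿ s n)
  onePower I I⊆ J⊆I a b (ζ , (ζ∈J , ζ-liouville , powers) , apart) =
    ζ , (ζ-liouville , J⊆I ζ ζ∈J , powers (a ÷ᶻ b) (÷ᶻ-nonZero a b) (I⊆ (J⊆I ζ ζ∈J))) , apart

theorem6p1 : ∀ {ℓ : Level} →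
    UncountablyMany (λ ζ → Liouville ζ × Σ (0ᴿ <ᴿ ζ) (λ 0<ζ →
    (a b : ℤ) .{{_ : ℤ.NonZero a}} .{{_ : ℤ.NonZero b}} →
    Liouville (proj₁ (f a b (ζ , 0<ζ)))))
    ×
    (∀ (I : Pred ℝ ℓ) (I⊆ : ∀ {z} → I z → 0ᴿ <ᴿ z) → ∃ (Interior I) →
    (a b : ℤ) .{{_ : ℤ.NonZero a}} .{{_ : ℤ.NonZero b}} →
    UncountablyMany (λ ζ → Liouville ζ × Σ (I ζ) (λ ζ∈I →
    Liouville (proj₁ (f a b (ζ , I⊆ ζ∈I))))))
theorem6p1 =
  -- Any interval would do; this one is (1, 2).
  (λ s → let J = interval 0<1 (p<p+q 0<1) in everyPower J s (liouvillePowers J s)) ,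
  λ I I⊆ interior a b s →
    let J , J⊆I = interior⇒interval I⊆ interior
    in onePower J s I I⊆ J⊆I a b (liouvillePowers J s)
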